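{- Let $W$ and $R$ be positive integers and let $\epsilon>0$ satisfy $\epsilon^{ -1}\le 2W\left(1-\frac{1}{\log W}\right)$. Set $\upsilon=\lceil\log(\epsilon^{ -1}\log W)\rceil$ and $k=\left\lceil\frac{1}{2\epsilon-2^{ -\upsilon}}\right\rceil$, and assume $\frac Wk$ is an integer. Then Algorithm 2 (described in the context, run with these parameters) requires $$\left(2\log W+\frac{1}{2\epsilon}\right)(1+o(1))$$ bits of memory.
   Context: All logarithms are base 2, and $o(1)$ is for $W\to\infty$. The memory of the algorithm is the number of bits used to store its variables. For $z\in[0,1]$, $\mathrm{Round}_{\upsilon}(z)$ denotes rounding of $z$ to the nearest value $\widetilde z$ such that $2^{\upsilon}\widetilde z$ is an integer. Algorithm 2 (processing a stream of integers in $\{0,1,\dots,R\}$, one call of Add per element). Variables: a fixed-point number $y$, integers $B,i,m$ and a bit array $b=(b_0,\dots,b_{k-1})$, all initialized to $0$. Add(element $x$): first set $x'=\mathrm{Round}_{\upsilon}\left(\frac xR\right)$. If $m=\frac Wk-1$, then do in order: (1) $B\leftarrow B-b_i$; (2) if $y+x'\ge\frac Wk$, set $b_i\leftarrow1$ and $y\leftarrow y-\frac Wk+x'$; otherwise set $b_i\leftarrow0$ and $y\leftarrow y+x'$; (3) $B\leftarrow B+b_i$; (4) $m\leftarrow0$; (5) $i\leftarrow i+1\bmod k$. Otherwise (if $m\ne\frac Wk-1$): $y\leftarrow y+x'$ and $m\leftarrow m+1$. Query: return $R\cdot\left(\frac Wk\cdot B+y-\frac W{2k}-m\cdot b_i\right)$.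 The variable $y$ is stored with $\lceil\log(2\frac Wk)\rceil$ bits for its integral part and $\upsilon$ bits for its fractional part; $m,i,B$ are stored as binary integers with enough bits for their ranges; $b$ is stored as $k$ bits. -}

module Defs where

open import Algebra.Definitions.RawSemiring using ()
open import Data.Bool.Base using (Bool; true; false; if_then_else_)
open import Data.Fin.Base using (Fin; toℕ; fromℕ<)
open import Data.Integer.Base as ℤ using (ℤ; +_; -[1+_]; 0ℤ; 1ℤ)
open import Data.List.Base using (List; foldl)
open import Data.Nat.Base as ℕ using (ℕ; zero; suc; NonZero)
open import Data.Nat.DivMod using (m%n<n)
open import Data.Nat.Logarithm using (⌈log₂_⌉)
open import Data.Nat.Properties using (_≟_)
open import Data.Product.Base using (∃-syntax; _×_)
open import Data.Rational.Base as ℚ using (ℚ; 0ℚ; ½; ceiling; ↥_; ↧ₙ_)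
open import Data.Rational.Properties using (_≤?_)
open import Data.Sum.Base using (_⊎_)
open import Data.Vec.Base using (Vec; lookup; replicate; _[_]≔_)
open import Relation.Binary.PropositionalEquality.Core using (_≡_)
open import Relation.Nullary.Decidable.Core using (does)
open import Relation.Nullary.Negation.Core using (¬_)

open Algebra.Definitions.RawSemiring ℚ.+-*-rawSemiring using (_^_)

ℤ→ℚ : ℤ → ℚ
ℤ→ℚ z = z ℚ./ 1

ℕ→ℚ : ℕ → ℚ
ℕ→ℚ n = ℤ→ℚ (+ n)

infixr 8 2^_

2^_ : ℤ → ℚ
2^ (+ n)    = ℕ→ℚ 2 ^ n
2^ -[1+ n ] = ½ ^ suc n

-- Dedekind reals.  The operations are defined on arbitrary pairs of
-- predicates; on (positive, for _⁻¹ and log) pairs satisfying IsReal they are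
-- the usual real operations.

record Cut : Set₁ where
  field
    L : ℚ → Set   -- L q means q < x
    U : ℚ → Set   -- U q means x < q

open Cut public

record IsReal (x : Cut) : Set where
  field
    L-inhabited : ∃[ q ] L x q
    U-inhabited : ∃[ q ] U x q
    L-lower     : ∀ {q r} → q ℚ.< r → L x r → L x q
    U-upper     : ∀ {q r} → q ℚ.< r → U x q → U x r
    L-open      : ∀ {q} → L x q → ∃[ r ] q ℚ.< r × L x r
    U-open      : ∀ {r} → U x r → ∃[ q ] q ℚ.< r × U x q
    disjoint    : ∀ {q} → ¬ (L x q × U x q)
    located     : ∀ {q r} → q ℚ.< r → L x q ⊎ U x r

infix  4 _<ʳ_ _≤ʳ_
infixl 6 _+ʳ_ _-ʳ_
infixl 7 _*ʳ_
infix  8 -ʳ_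
infix  9 _⁻¹

_<ʳ_ : Cut → Cut → Set
x <ʳ y = ∃[ q ] U x q × L y q

_≤ʳ_ : Cut → Cut → Set
x ≤ʳ y = ¬ (y <ʳ x)

fromℚ : ℚ → Cut
fromℚ p .L q = q ℚ.< p
fromℚ p .U q = p ℚ.< q

fromℤ : ℤ → Cut
fromℤ z = fromℚ (ℤ→ℚ z)

fromℕ : ℕ → Cut
fromℕ n = fromℤ (+ n)

_+ʳ_ : Cut → Cut → Cut
(x +ʳ y) .L q = ∃[ a ] ∃[ b ] L x a × L y b × q ≡ a ℚ.+ b
(x +ʳ y) .U q = ∃[ a ] ∃[ b ] U x a × U y b × q ≡ a ℚ.+ b

-ʳ_ : Cut → Cut
(-ʳ x) .L q = U x (ℚ.- q)
(-ʳ x) .U q = L x (ℚ.- q)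

_-ʳ_ : Cut → Cut → Cut
x -ʳ y = x +ʳ (-ʳ y)

-- Interval arithmetic: if a < x < b and c < y < d, then x y lies strictly
-- between the least and the greatest of a c, a d, b c, b d.
_*ʳ_ : Cut → Cut → Cut
(x *ʳ y) .L q = ∃[ a ] ∃[ b ] ∃[ c ] ∃[ d ] L x a × U x b × L y c × U y d ×
  q ℚ.< a ℚ.* c × q ℚ.< a ℚ.* d × q ℚ.< b ℚ.* c × q ℚ.< b ℚ.* d
(x *ʳ y) .U q = ∃[ a ] ∃[ b ] ∃[ c ] ∃[ d ] L x a × U x b × L y c × U y d ×
  a ℚ.* c ℚ.< q × a ℚ.* d ℚ.< q × b ℚ.* c ℚ.< q × b ℚ.* d ℚ.< q

-- Meaningful for x > 0 only.
_⁻¹ : Cut → Cut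
(x ⁻¹) .L q = ∃[ u ] U x u × q ℚ.* u ℚ.< ℚ.1ℚ
(x ⁻¹) .U q = ∃[ l ] 0ℚ ℚ.< l × L x l × ℚ.1ℚ ℚ.< q ℚ.* l

-- Base 2, meaningful for x > 0 only: for q = n / d, q < log x iff 2 ^ n < x ^ d.
log : Cut → Cut
log x .L q = ∃[ a ] 0ℚ ℚ.< a × L x a × 2^ (↥ q) ℚ.< a ^ (↧ₙ q)
log x .U q = ∃[ b ] U x b × b ^ (↧ₙ q) ℚ.< 2^ (↥ q)

-- z = ⌈ x ⌉
IsCeiling : ℤ → Cut → Set
IsCeiling z x = fromℤ (z ℤ.- 1ℤ) <ʳ x × x ≤ʳ fromℤ z

-- Nearest multiple of 2 ^ (- υ).  Ties go down, so that [0,1] is mapped to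
-- itself even when υ = -1, where 1 lies midway between 0 and 2.
Round : ℤ → ℚ → ℚ
Round υ z = ℤ→ℚ (ceiling (2^ υ ℚ.* z ℚ.- ½)) ℚ.* 2^ (ℤ.- υ)

bit : Bool → ℕ
bit false = 0
bit true  = 1

module Algorithm (W R : ℕ) .{{_ : NonZero R}} (υ : ℤ) (k : ℕ) .{{_ : NonZero k}} where

  -- W / k, which is exact when k ∣ W
  block : ℕ
  block = W ℕ./ k

  record State : Set where
    constructor state
    field
      y : ℚ
      B : ℤ
      i : Fin k
      m : ℕ
      b : Vec Bool k

  open State public

  initial : State
  initial = state 0ℚ 0ℤ (fromℕ< (ℕ.>-nonZero⁻¹ k)) 0 (replicate k false)

  next : Fin k → Fin k
  next j = fromℕ< (m%n<n (suc (toℕ j)) k)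

  add : State → Fin (suc R) → State
  add (state y B i m b) x =
    if does (m ≟ block ℕ.∸ 1)
    then state (if overflow then y ℚ.- ℕ→ℚ block ℚ.+ x′ else y ℚ.+ x′)
               (B ℤ.- + bit (lookup b i) ℤ.+ + bit overflow)
               (next i)
               0
               (b [ i ]≔ overflow)
    else state (y ℚ.+ x′) B i (suc m) b
    where
    x′ : ℚ
    x′ = Round υ (+ toℕ x ℚ./ R)

    overflow : Bool
    overflow = does (ℕ→ℚ block ≤? y ℚ.+ x′)

  query : State → ℚ
  query (state y B i m b) = ℕ→ℚ R ℚ.*
    (ℕ→ℚ block ℚ.* ℤ→ℚ B ℚ.+ y ℚ.- ℕ→ℚ block ℚ.* ½ ℚ.- ℕ→ℚ m ℚ.* ℕ→ℚ (bit (lookup b i)))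

  run : List (Fin (suc R)) → State
  run = foldl add initial

  Fits : (State → ℤ) → ℕ → Set
  Fits var w = ∀ xs → 0ℤ ℤ.≤ var (run xs) × var (run xs) ℤ.< + (2 ℕ.^ w)

  -- w is the least number of bits that can hold every value taken by var.
  IsWidth : (State → ℤ) → ℕ → Set
  IsWidth var w = Fits var w × (∀ w′ → Fits var w′ → w ℕ.≤ w′)

  integralBits : ℕ
  integralBits = ⌈log₂ (2 ℕ.* block) ⌉

  -- No fractional bits when υ ≤ 0, since y is then an integer.
  fractionalBits : ℕ
  fractionalBits = ℤ.∣ υ ℤ.⊔ 0ℤ ∣

  RequiresBits : ℕ → Set
  RequiresBits M = ∃[ mBits ] ∃[ iBits ] ∃[ BBits ]
    IsWidth (λ s → + m s) mBits ×
    IsWidth (λ s → + toℕ (i s)) iBits ×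
    IsWidth B BBits ×
    M ≡ (integralBits ℕ.+ fractionalBits) ℕ.+ mBits ℕ.+ iBits ℕ.+ BBits ℕ.+ k

module Submission where

open import Defs
open import Data.Integer.Base as ℤ using (ℤ; +_)
open import Data.Nat.Base as ℕ using (ℕ; NonZero)
open import Data.Nat.Divisibility using (_∣_)
open import Data.Product.Base using (∃-syntax; _×_)
open import Data.Rational.Base as ℚ using (ℚ; 0ℚ; 1ℚ)

open import Algebra.Bundles using (CommutativeRing)
import Algebra.Definitions.RawSemiring
import Algebra.Properties.Semiring.Exp
open import Data.Bool.Base using (Bool; true; false; if_then_else_)
open import Data.Fin.Base as Fin using (Fin; zero; suc; toℕ)
import Data.Fin.Properties as Finₚ
open import Data.Integer.Base using (-[1+_]; 0ℤ; 1ℤ)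
import Data.Integer.DivMod as ℤ
import Data.Integer.Properties as ℤₚ
open import Data.List.Base using ([]; _∷_; foldl; _∷ʳ_)
open import Data.List.Properties using (foldl-∷ʳ)
open import Data.Nat.Base using (zero; suc; z≤n; s≤s)
import Data.Nat.Coprimality as Coprimality
open import Data.Nat.DivMod using (m%n<n; m<n⇒m%n≡m; m/n*n≡m)
open import Data.Nat.Induction using (<-rec)
open import Data.Nat.Logarithm
  using (⌈log₂_⌉; ⌈log₂⌉-mono-≤; ⌈log₂⌈n/2⌉⌉≡⌈log₂n⌉∸1; ⌈log₂2*n⌉≡1+⌈log₂n⌉; ⌈log₂2^n⌉≡n)
import Data.Nat.Properties as ℕₚ
import Data.Nat.Tactic.RingSolver as ℕ-solver
open import Data.Product.Base using (_,_; proj₁; proj₂)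
open import Data.Rational.Base using (mkℚ; ½; ceiling; floor; ↥_; ↧ₙ_)
import Data.Rational.Properties as ℚₚ
import Data.Rational.Unnormalised.Base as ℚᵘ
import Data.Rational.Unnormalised.Properties as ℚᵘₚ
open import Data.Sum.Base using (_⊎_; inj₁; inj₂)
open import Data.Vec.Base using (Vec; []; _∷_; lookup; replicate; _[_]≔_)
import Data.Vec.Properties as Vecₚ
open import Relation.Binary.Definitions using (tri<; tri≈; tri>)
open import Relation.Binary.PropositionalEquality
  using (_≡_; _≢_; refl; sym; trans; cong; cong₂; subst; subst₂)
open import Relation.Nullary using (Dec; yes; no; ¬_; contradiction)
open import Relation.Nullary.Decidable using (does; dec-true; dec-false; dec⇒maybe)
open import Tactic.RingSolver using (solve-∀)
open import Tactic.RingSolver.Core.AlmostCommutativeRing using (AlmostCommutativeRing; fromCommutativeRing)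

open Algebra.Definitions.RawSemiring ℚ.+-*-rawSemiring using (_^_)
open Algebra.Properties.Semiring.Exp (CommutativeRing.semiring ℚₚ.+-*-commutativeRing) using (^-assocʳ)

-- Write n for the integer part of log W, block for W / k, u for the
-- fractional width max υ 0, and ⌈log₂_⌉ for the binary width function.
--
-- The memory.  Feeding maximal elements drives m through 0, ..., block - 1
-- and i through 0, ..., k - 1, so m and i need exactly ⌈log₂ block⌉ and
-- ⌈log₂ k⌉ bits (m-width, i-width).  The variable B always counts the ones in
-- the bit array (B≡ones), hence lies between 0 and k.  Its exact width depends
-- on υ.  If υ ≥ 0, maximal elements are rounded to 1, every block ends with an
-- overflow, and after k blocks B = k.  If υ < 0, every element is rounded to 0
-- and B stays 0.  In both cases B needs at most ⌈log₂ k⌉ + 1 bits.  Since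
-- block * k = W, the widths of block and k add up to n up to an error of 2.
-- With 1 + ⌈log₂ block⌉ bits for the integral part of y, the total M satisfies
--   2n + 1 + k - ⌈log₂ k⌉ ≤ M ≤ 2n + 6 + u + k     (memory-≥, memory-≤).
--
-- The target 2 log W + 1 / (2ε).  Its first summand lies between 2n and
-- 2 (n + 1).  Since 2ε - 2^(-υ) < 2ε, the choice of k gives 1 / (2ε) ≤ k
-- (L-⁻¹-≤).  Since log (log W / ε) ≤ υ, the number 2^(-υ) is at most a
-- O(1 / log W) fraction of ε (2^-υ-small), so that 1 / (2ε) is at least
-- (k - 1) (1 - o(1)) (U-⁻¹-≥).  Since υ - 1 < log (log W / ε), also
-- 2^υ = O(k log W) (2^υ-bound), so u ≤ log k + log log W + O(1).
--
-- Both log k = o(k) and log log W = o(log W) have an explicit form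
-- (N*⌈log₂m⌉≤m+N*[1+N]), so all error terms are at most a δ fraction of
-- 2n + k once n exceeds a constant depending on δ only (lower-arith,
-- upper-arith).
--
-- Real numbers are treated one rational bound at a time: x ≤ʳ y is the
-- negation of x <ʳ y, so each of the two inequalities is proved by refuting
-- the rational number that would separate the two sides.

-- Binary logarithms of natural numbers

⌈log₂⌉-least : ∀ {m} w → m ℕ.≤ 2 ℕ.^ w → ⌈log₂ m ⌉ ℕ.≤ w
⌈log₂⌉-least w m≤2^w = subst (_ ℕ.≤_) (⌈log₂2^n⌉≡n w) (⌈log₂⌉-mono-≤ m≤2^w)

m≤2^⌈log₂m⌉ : ∀ m → m ℕ.≤ 2 ℕ.^ ⌈log₂ m ⌉
m≤2^⌈log₂m⌉ = <-rec _ bound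
  where
  -- The truncated exponent c ∸ 1 is exact except for c ≡ 0.
  2∸1 : ∀ c → 2 ℕ.* 2 ℕ.^ (c ℕ.∸ 1) ℕ.≤ 2 ℕ.^ c ⊎ c ≡ 0
  2∸1 zero    = inj₂ refl
  2∸1 (suc c) = inj₁ ℕₚ.≤-refl

  bound : ∀ m → (∀ {j} → j ℕ.< m → j ℕ.≤ 2 ℕ.^ ⌈log₂ j ⌉) → m ℕ.≤ 2 ℕ.^ ⌈log₂ m ⌉
  bound 0 _ = z≤n
  bound 1 _ = ℕₚ.m^n>0 2 ⌈log₂ 1 ⌉
  bound m@(suc (suc m′)) rec with 2∸1 ⌈log₂ m ⌉
  ... | inj₂ c≡0 = contradiction
    (subst (1 ℕ.≤_) c≡0 (⌈log₂⌉-mono-≤ {2} {m} (s≤s (s≤s z≤n)))) λ ()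
  ... | inj₁ 2∸1≤ = begin
    m                                     ≡⟨ ℕₚ.⌊n/2⌋+⌈n/2⌉≡n m ⟨
    ℕ.⌊ m /2⌋ ℕ.+ ℕ.⌈ m /2⌉               ≤⟨ ℕₚ.+-monoˡ-≤ _ (ℕₚ.⌊n/2⌋≤⌈n/2⌉ m) ⟩
    ℕ.⌈ m /2⌉ ℕ.+ ℕ.⌈ m /2⌉               ≡⟨ cong (ℕ.⌈ m /2⌉ ℕ.+_) (sym (ℕₚ.+-identityʳ _)) ⟩
    2 ℕ.* ℕ.⌈ m /2⌉                       ≤⟨ ℕₚ.*-monoʳ-≤ 2 (rec (ℕₚ.⌈n/2⌉<n m′)) ⟩
    2 ℕ.* 2 ℕ.^ ⌈log₂ ℕ.⌈ m /2⌉ ⌉         ≡⟨ cong (λ c → 2 ℕ.* 2 ℕ.^ c) (⌈log₂⌈n/2⌉⌉≡⌈log₂n⌉∸1 m) ⟩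
    2 ℕ.* 2 ℕ.^ (⌈log₂ m ⌉ ℕ.∸ 1)         ≤⟨ 2∸1≤ ⟩
    2 ℕ.^ ⌈log₂ m ⌉                       ∎
    where open ℕₚ.≤-Reasoning

⌈log₂⌉≡suc⇒2^< : ∀ {m c} → ⌈log₂ m ⌉ ≡ suc c → 2 ℕ.^ c ℕ.< m
⌈log₂⌉≡suc⇒2^< {m} {c} eq = ℕₚ.≰⇒> λ m≤2^c →
  ℕₚ.<-irrefl refl (subst (ℕ._≤ c) eq (⌈log₂⌉-least c m≤2^c))

2^-cancel-< : ∀ {m n} → 2 ℕ.^ m ℕ.< 2 ℕ.^ n → m ℕ.< n
2^-cancel-< {m} {n} lt = ℕₚ.≰⇒> λ n≤m → ℕₚ.<⇒≱ lt (ℕₚ.^-monoʳ-≤ 2 n≤m)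

⌊log₂⌋-exists : ∀ W .{{_ : NonZero W}} → ∃[ n ] 2 ℕ.^ n ℕ.≤ W × W ℕ.< 2 ℕ.^ suc n
⌊log₂⌋-exists (suc W) with ⌈log₂ 2 ℕ.+ W ⌉ in eq
... | zero  = contradiction
  (subst (2 ℕ.+ W ℕ.≤_) (cong (2 ℕ.^_) eq) (m≤2^⌈log₂m⌉ (2 ℕ.+ W))) λ { (s≤s ()) }
... | suc n = n , ℕ.s≤s⁻¹ (⌈log₂⌉≡suc⇒2^< eq) ,
  subst (2 ℕ.+ W ℕ.≤_) (cong (2 ℕ.^_) eq) (m≤2^⌈log₂m⌉ (2 ℕ.+ W))

-- The binary widths of two factors add up to the logarithm of the product, up
-- to an error of two.

⌈log₂⌉-factors-≥ : ∀ {n} a b → 2 ℕ.^ n ℕ.≤ a ℕ.* b → n ℕ.≤ ⌈log₂ a ⌉ ℕ.+ ⌈log₂ b ⌉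
⌈log₂⌉-factors-≥ {n} a b 2^n≤ = subst (ℕ._≤ ⌈log₂ a ⌉ ℕ.+ ⌈log₂ b ⌉) (⌈log₂2^n⌉≡n n)
  (⌈log₂⌉-least _ (begin
    2 ℕ.^ n                              ≤⟨ 2^n≤ ⟩
    a ℕ.* b                              ≤⟨ ℕₚ.*-mono-≤ (m≤2^⌈log₂m⌉ a) (m≤2^⌈log₂m⌉ b) ⟩
    2 ℕ.^ ⌈log₂ a ⌉ ℕ.* 2 ℕ.^ ⌈log₂ b ⌉  ≡⟨ ℕₚ.^-distribˡ-+-* 2 ⌈log₂ a ⌉ ⌈log₂ b ⌉ ⟨
    2 ℕ.^ (⌈log₂ a ⌉ ℕ.+ ⌈log₂ b ⌉)      ∎))
  where open ℕₚ.≤-Reasoning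

2^⌈log₂⌉≤2* : ∀ m .{{_ : NonZero m}} → 2 ℕ.^ ⌈log₂ m ⌉ ℕ.≤ 2 ℕ.* m
2^⌈log₂⌉≤2* m@(suc _) with ⌈log₂ m ⌉ in eq
... | zero  = s≤s z≤n
... | suc c = ℕₚ.*-monoʳ-≤ 2 (ℕₚ.<⇒≤ (⌈log₂⌉≡suc⇒2^< {m} eq))

⌈log₂⌉-factors-≤ : ∀ {n} a b .{{_ : NonZero a}} .{{_ : NonZero b}} →
                   a ℕ.* b ℕ.< 2 ℕ.^ suc n → ⌈log₂ a ⌉ ℕ.+ ⌈log₂ b ⌉ ℕ.≤ 2 ℕ.+ n
⌈log₂⌉-factors-≤ {n} a b ab< = ℕ.s≤s⁻¹ (2^-cancel-< (begin-strict
    2 ℕ.^ (⌈log₂ a ⌉ ℕ.+ ⌈log₂ b ⌉)      ≡⟨ ℕₚ.^-distribˡ-+-* 2 ⌈log₂ a ⌉ ⌈log₂ b ⌉ ⟩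
    2 ℕ.^ ⌈log₂ a ⌉ ℕ.* 2 ℕ.^ ⌈log₂ b ⌉  ≤⟨ ℕₚ.*-mono-≤ (2^⌈log₂⌉≤2* a) (2^⌈log₂⌉≤2* b) ⟩
    2 ℕ.* a ℕ.* (2 ℕ.* b)                ≡⟨ regroup a b ⟩
    4 ℕ.* (a ℕ.* b)                      <⟨ ℕₚ.*-monoʳ-< 4 ab< ⟩
    4 ℕ.* 2 ℕ.^ suc n                    ≡⟨ ℕₚ.*-assoc 2 2 (2 ℕ.^ suc n) ⟩
    2 ℕ.^ (3 ℕ.+ n)                      ∎))
  where
  open ℕₚ.≤-Reasoning
  regroup : ∀ a b → 2 ℕ.* a ℕ.* (2 ℕ.* b) ≡ 4 ℕ.* (a ℕ.* b)
  regroup = ℕ-solver.solve-∀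

n<2^n : ∀ n → n ℕ.< 2 ℕ.^ n
n<2^n zero    = s≤s z≤n
n<2^n (suc n) = begin-strict
  suc n                  <⟨ s≤s (n<2^n n) ⟩
  1 ℕ.+ 2 ℕ.^ n          ≤⟨ ℕₚ.+-monoˡ-≤ _ (ℕₚ.m^n>0 2 n) ⟩
  2 ℕ.^ n ℕ.+ 2 ℕ.^ n    ≡⟨ cong (2 ℕ.^ n ℕ.+_) (sym (ℕₚ.+-identityʳ _)) ⟩
  2 ℕ.^ suc n            ∎
  where open ℕₚ.≤-Reasoning

-- For c < N the summand N * N suffices; beyond, 2 ^ c grows by at least N per step.
N*c≤2^c+N*N : ∀ N c → N ℕ.* c ℕ.≤ 2 ℕ.^ c ℕ.+ N ℕ.* N
N*c≤2^c+N*N N zero    = ℕₚ.≤-trans (ℕₚ.≤-reflexive (ℕₚ.*-zeroʳ N)) z≤n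
N*c≤2^c+N*N N (suc c) with ℕₚ.<-≤-connex c N
... | inj₁ c<N = ℕₚ.≤-trans (ℕₚ.*-monoʳ-≤ N c<N) (ℕₚ.m≤n+m _ _)
... | inj₂ N≤c = begin
  N ℕ.* suc c                               ≡⟨ ℕₚ.*-suc N c ⟩
  N ℕ.+ N ℕ.* c                             ≤⟨ ℕₚ.+-mono-≤ (ℕₚ.≤-trans N≤c (ℕₚ.<⇒≤ (n<2^n c))) (N*c≤2^c+N*N N c) ⟩
  2 ℕ.^ c ℕ.+ (2 ℕ.^ c ℕ.+ N ℕ.* N)         ≡⟨ double (2 ℕ.^ c) (N ℕ.* N) ⟩
  2 ℕ.^ suc c ℕ.+ N ℕ.* N                   ∎
  where
  open ℕₚ.≤-Reasoning
  double : ∀ x y → x ℕ.+ (x ℕ.+ y) ≡ 2 ℕ.* x ℕ.+ y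
  double = ℕ-solver.solve-∀

-- log m = o(m) in explicit form: ⌈log₂ m⌉ ≤ m / N + O(1) for every N.
N*⌈log₂m⌉≤m+N*[1+N] : ∀ N m → N ℕ.* ⌈log₂ m ⌉ ℕ.≤ m ℕ.+ N ℕ.* suc N
N*⌈log₂m⌉≤m+N*[1+N] N m with ⌈log₂ m ⌉ in eq
... | zero  = ℕₚ.≤-trans (ℕₚ.≤-reflexive (ℕₚ.*-zeroʳ N)) z≤n
... | suc c = begin
  N ℕ.* suc c                  ≡⟨ ℕₚ.*-suc N c ⟩
  N ℕ.+ N ℕ.* c                ≤⟨ ℕₚ.+-monoʳ-≤ N (N*c≤2^c+N*N N c) ⟩
  N ℕ.+ (2 ℕ.^ c ℕ.+ N ℕ.* N)  ≤⟨ ℕₚ.+-monoʳ-≤ N (ℕₚ.+-monoˡ-≤ _ (ℕₚ.<⇒≤ (⌈log₂⌉≡suc⇒2^< {m} eq))) ⟩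
  N ℕ.+ (m ℕ.+ N ℕ.* N)        ≡⟨ regroup N m ⟩
  m ℕ.+ N ℕ.* suc N            ∎
  where
  open ℕₚ.≤-Reasoning
  regroup : ∀ N m → N ℕ.+ (m ℕ.+ N ℕ.* N) ≡ m ℕ.+ N ℕ.* suc N
  regroup = ℕ-solver.solve-∀

-- Estimates of the lower order terms

-- A bound on log W beyond which the lower order terms of the memory are at
-- most a 1 / N fraction of 2 log W + k.  The last summand is twice the constant
-- N′ * (1 + N′) of N*⌈log₂m⌉≤m+N*[1+N] for N′ = 2N, once for k and once for log W.
threshold : ℕ → ℕ
threshold N = 20 ℕ.* N ℕ.+ 2 ℕ.+ 2 ℕ.* (2 ℕ.* N ℕ.* suc (2 ℕ.* N))

-- If M ≥ 2n + 1 + k - log k, then M is at least (1 - 1/(N+1)) times the upper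
-- bound 2n + 2 + k on the target.
lower-arith : ∀ {N n k M} → threshold (suc N) ℕ.≤ n →
  2 ℕ.* n ℕ.+ 1 ℕ.+ k ℕ.≤ M ℕ.+ ⌈log₂ k ⌉ →
  N ℕ.* (2 ℕ.* n ℕ.+ 2 ℕ.+ k) ℕ.≤ suc N ℕ.* M
lower-arith {N} {n} {k} {M} n≥ hyp = ℕₚ.+-cancelʳ-≤ (2 ℕ.* n ℕ.+ 1 ℕ.+ k) _ _ (begin
  N ℕ.* (2 ℕ.* n ℕ.+ 2 ℕ.+ k) ℕ.+ (2 ℕ.* n ℕ.+ 1 ℕ.+ k)
    ≡⟨ eq₁ N n k ⟩
  suc N ℕ.* (2 ℕ.* n ℕ.+ 1 ℕ.+ k) ℕ.+ N
    ≤⟨ ℕₚ.+-monoˡ-≤ N (ℕₚ.*-monoʳ-≤ (suc N) hyp) ⟩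
  suc N ℕ.* (M ℕ.+ q) ℕ.+ N
    ≡⟨ eq₂ N M q ⟩
  suc N ℕ.* M ℕ.+ (suc N ℕ.* q ℕ.+ N)
    ≤⟨ ℕₚ.+-monoʳ-≤ (suc N ℕ.* M) (ℕₚ.+-monoˡ-≤ N (N*⌈log₂m⌉≤m+N*[1+N] (suc N) k)) ⟩
  suc N ℕ.* M ℕ.+ (k ℕ.+ suc N ℕ.* suc (suc N) ℕ.+ N)
    ≤⟨ ℕₚ.m≤m+n _ _ ⟩
  suc N ℕ.* M ℕ.+ (k ℕ.+ suc N ℕ.* suc (suc N) ℕ.+ N) ℕ.+ slack
    ≡⟨ eq₃ N M k ⟩
  suc N ℕ.* M ℕ.+ (threshold (suc N) ℕ.+ k)
    ≤⟨ ℕₚ.+-monoʳ-≤ (suc N ℕ.* M) (ℕₚ.+-monoˡ-≤ k (ℕₚ.≤-trans n≥ (ℕₚ.≤-trans (ℕₚ.m≤m+n n _) (ℕₚ.m≤m+n _ 1)))) ⟩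
  suc N ℕ.* M ℕ.+ (2 ℕ.* n ℕ.+ 1 ℕ.+ k) ∎)
  where
  open ℕₚ.≤-Reasoning
  q = ⌈log₂ k ⌉
  slack = 22 ℕ.* suc N ℕ.+ 3 ℕ.+ 7 ℕ.* suc N ℕ.* suc N
  eq₁ : ∀ N n k → N ℕ.* (2 ℕ.* n ℕ.+ 2 ℕ.+ k) ℕ.+ (2 ℕ.* n ℕ.+ 1 ℕ.+ k) ≡ suc N ℕ.* (2 ℕ.* n ℕ.+ 1 ℕ.+ k) ℕ.+ N
  eq₁ = ℕ-solver.solve-∀
  eq₂ : ∀ N M q → suc N ℕ.* (M ℕ.+ q) ℕ.+ N ≡ suc N ℕ.* M ℕ.+ (suc N ℕ.* q ℕ.+ N)
  eq₂ = ℕ-solver.solve-∀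
  eq₃ : ∀ N M k →
    suc N ℕ.* M ℕ.+ (k ℕ.+ suc N ℕ.* suc (suc N) ℕ.+ N) ℕ.+ (22 ℕ.* suc N ℕ.+ 3 ℕ.+ 7 ℕ.* suc N ℕ.* suc N)
    ≡ suc N ℕ.* M ℕ.+ ((20 ℕ.* suc N ℕ.+ 2 ℕ.+ 2 ℕ.* (2 ℕ.* suc N ℕ.* suc (2 ℕ.* suc N))) ℕ.+ k)
  eq₃ = ℕ-solver.solve-∀

-- For k + 1 blocks, u ≤ log (k + 1) + log (n + 1) + O(1) is a lower order term.
fractional-arith : ∀ {N n k u} → threshold N ℕ.≤ n →
  2 ℕ.^ u ℕ.< 8 ℕ.* suc k ℕ.* suc n →
  2 ℕ.* N ℕ.* (7 ℕ.+ u) ℕ.≤ 4 ℕ.* n ℕ.+ k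
fractional-arith {N} {n} {k} {u} n≥ hyp = begin
  2 ℕ.* N ℕ.* (7 ℕ.+ u)
    ≤⟨ ℕₚ.*-monoʳ-≤ (2 ℕ.* N) (ℕₚ.+-monoʳ-≤ 7 (ℕₚ.<⇒≤ u<)) ⟩
  2 ℕ.* N ℕ.* (7 ℕ.+ (3 ℕ.+ (q ℕ.+ r)))
    ≡⟨ eq₁ N q r ⟩
  20 ℕ.* N ℕ.+ (2 ℕ.* N ℕ.* q ℕ.+ 2 ℕ.* N ℕ.* r)
    ≤⟨ ℕₚ.+-monoʳ-≤ (20 ℕ.* N) (ℕₚ.+-mono-≤ (N*⌈log₂m⌉≤m+N*[1+N] (2 ℕ.* N) (suc k)) (N*⌈log₂m⌉≤m+N*[1+N] (2 ℕ.* N) (suc n))) ⟩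
  20 ℕ.* N ℕ.+ ((suc k ℕ.+ C) ℕ.+ (suc n ℕ.+ C))
    ≡⟨ eq₂ (20 ℕ.* N) k n C ⟩
  threshold N ℕ.+ (n ℕ.+ k)
    ≤⟨ ℕₚ.+-monoˡ-≤ (n ℕ.+ k) n≥ ⟩
  n ℕ.+ (n ℕ.+ k)
    ≤⟨ ℕₚ.m≤m+n _ (2 ℕ.* n) ⟩
  n ℕ.+ (n ℕ.+ k) ℕ.+ 2 ℕ.* n
    ≡⟨ eq₃ n k ⟩
  4 ℕ.* n ℕ.+ k ∎
  where
  open ℕₚ.≤-Reasoning
  q = ⌈log₂ suc k ⌉
  r = ⌈log₂ suc n ⌉
  C = 2 ℕ.* N ℕ.* suc (2 ℕ.* N)
  u< : u ℕ.< 3 ℕ.+ (q ℕ.+ r)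
  u< = 2^-cancel-< (begin-strict
    2 ℕ.^ u                           <⟨ hyp ⟩
    8 ℕ.* suc k ℕ.* suc n             ≡⟨ ℕₚ.*-assoc 8 (suc k) (suc n) ⟩
    8 ℕ.* (suc k ℕ.* suc n)           ≤⟨ ℕₚ.*-monoʳ-≤ 8 (ℕₚ.*-mono-≤ (m≤2^⌈log₂m⌉ (suc k)) (m≤2^⌈log₂m⌉ (suc n))) ⟩
    8 ℕ.* (2 ℕ.^ q ℕ.* 2 ℕ.^ r)       ≡⟨ cong (8 ℕ.*_) (ℕₚ.^-distribˡ-+-* 2 q r) ⟨
    8 ℕ.* 2 ℕ.^ (q ℕ.+ r)             ≡⟨ ℕₚ.^-distribˡ-+-* 2 3 (q ℕ.+ r) ⟨
    2 ℕ.^ (3 ℕ.+ (q ℕ.+ r))           ∎)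
  eq₁ : ∀ N q r → 2 ℕ.* N ℕ.* (7 ℕ.+ (3 ℕ.+ (q ℕ.+ r))) ≡ 20 ℕ.* N ℕ.+ (2 ℕ.* N ℕ.* q ℕ.+ 2 ℕ.* N ℕ.* r)
  eq₁ = ℕ-solver.solve-∀
  eq₂ : ∀ a k n C → a ℕ.+ ((suc k ℕ.+ C) ℕ.+ (suc n ℕ.+ C)) ≡ (a ℕ.+ 2 ℕ.+ 2 ℕ.* C) ℕ.+ (n ℕ.+ k)
  eq₂ = ℕ-solver.solve-∀
  eq₃ : ∀ n k → n ℕ.+ (n ℕ.+ k) ℕ.+ 2 ℕ.* n ≡ 4 ℕ.* n ℕ.+ k
  eq₃ = ℕ-solver.solve-∀

-- For k + 1 blocks and T = 4 (N + 1), the target is at least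
-- 2n + k (1 - 1/T).  Multiplied by T, this is the last factor below, and M is
-- at most (1 + 1/(N+1)) times this lower bound.
upper-arith : ∀ {N n k u M} →
  2 ℕ.* suc N ℕ.* (7 ℕ.+ u) ℕ.≤ 4 ℕ.* n ℕ.+ k →
  M ℕ.≤ 2 ℕ.* n ℕ.+ 7 ℕ.+ u ℕ.+ k →
  4 ℕ.* suc N ℕ.* (suc N ℕ.* M) ℕ.≤
  suc (suc N) ℕ.* (8 ℕ.* suc N ℕ.* n ℕ.+ k ℕ.* (3 ℕ.+ 4 ℕ.* N))
upper-arith {N} {n} {k} {u} {M} small hyp = begin
  4 ℕ.* suc N ℕ.* (suc N ℕ.* M)
    ≤⟨ ℕₚ.*-monoʳ-≤ (4 ℕ.* suc N) (ℕₚ.*-monoʳ-≤ (suc N) hyp) ⟩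
  4 ℕ.* suc N ℕ.* (suc N ℕ.* (2 ℕ.* n ℕ.+ 7 ℕ.+ u ℕ.+ k))
    ≡⟨ eq₁ N n u k ⟩
  4 ℕ.* suc N ℕ.* (suc N ℕ.* (2 ℕ.* n ℕ.+ k)) ℕ.+ 2 ℕ.* suc N ℕ.* (2 ℕ.* suc N ℕ.* (7 ℕ.+ u))
    ≤⟨ ℕₚ.+-monoʳ-≤ (4 ℕ.* suc N ℕ.* (suc N ℕ.* (2 ℕ.* n ℕ.+ k))) (ℕₚ.*-monoʳ-≤ (2 ℕ.* suc N) small) ⟩
  4 ℕ.* suc N ℕ.* (suc N ℕ.* (2 ℕ.* n ℕ.+ k)) ℕ.+ 2 ℕ.* suc N ℕ.* (4 ℕ.* n ℕ.+ k)
    ≤⟨ ℕₚ.m≤m+n _ (k ℕ.* N) ⟩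
  4 ℕ.* suc N ℕ.* (suc N ℕ.* (2 ℕ.* n ℕ.+ k)) ℕ.+ 2 ℕ.* suc N ℕ.* (4 ℕ.* n ℕ.+ k) ℕ.+ k ℕ.* N
    ≡⟨ eq₂ N n k ⟩
  suc (suc N) ℕ.* (8 ℕ.* suc N ℕ.* n ℕ.+ k ℕ.* (3 ℕ.+ 4 ℕ.* N)) ∎
  where
  open ℕₚ.≤-Reasoning
  eq₁ : ∀ N n u k → 4 ℕ.* suc N ℕ.* (suc N ℕ.* (2 ℕ.* n ℕ.+ 7 ℕ.+ u ℕ.+ k)) ≡
    4 ℕ.* suc N ℕ.* (suc N ℕ.* (2 ℕ.* n ℕ.+ k)) ℕ.+ 2 ℕ.* suc N ℕ.* (2 ℕ.* suc N ℕ.* (7 ℕ.+ u))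
  eq₁ = ℕ-solver.solve-∀
  eq₂ : ∀ N n k → 4 ℕ.* suc N ℕ.* (suc N ℕ.* (2 ℕ.* n ℕ.+ k)) ℕ.+ 2 ℕ.* suc N ℕ.* (4 ℕ.* n ℕ.+ k) ℕ.+ k ℕ.* N ≡
    suc (suc N) ℕ.* (8 ℕ.* suc N ℕ.* n ℕ.+ k ℕ.* (3 ℕ.+ 4 ℕ.* N))
  eq₂ = ℕ-solver.solve-∀

-- Rational arithmetic

ℚ-ring : AlmostCommutativeRing _ _
ℚ-ring = fromCommutativeRing ℚₚ.+-*-commutativeRing (λ x → dec⇒maybe (0ℚ ℚₚ.≟ x))

<⇒≱ : ∀ {p q} → p ℚ.< q → ¬ q ℚ.≤ p
<⇒≱ p<q q≤p = ℚₚ.<-irrefl refl (ℚₚ.<-≤-trans p<q q≤p)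

-- The fraction z / 1 is in lowest terms.
ℤ→ℚ≡ : ∀ z → ℤ→ℚ z ≡ mkℚ z 0 (Coprimality.sym (Coprimality.1-coprimeTo ℤ.∣ z ∣))
ℤ→ℚ≡ z = ℚₚ.↥p/↧p≡p (mkℚ z 0 (Coprimality.sym (Coprimality.1-coprimeTo ℤ.∣ z ∣)))

↥-ℤ→ℚ : ∀ z → ↥ ℤ→ℚ z ≡ z
↥-ℤ→ℚ z = cong ↥_ (ℤ→ℚ≡ z)

↧ₙ-ℤ→ℚ : ∀ z → ↧ₙ ℤ→ℚ z ≡ 1
↧ₙ-ℤ→ℚ z = cong ↧ₙ_ (ℤ→ℚ≡ z)

ℤ→ℚ-+ : ∀ y z → ℤ→ℚ (y ℤ.+ z) ≡ ℤ→ℚ y ℚ.+ ℤ→ℚ z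
ℤ→ℚ-+ y z = sym (trans (cong₂ ℚ._+_ (ℤ→ℚ≡ y) (ℤ→ℚ≡ z))
  (cong ℤ→ℚ (cong₂ ℤ._+_ (ℤₚ.*-identityʳ y) (ℤₚ.*-identityʳ z))))

ℤ→ℚ-* : ∀ y z → ℤ→ℚ (y ℤ.* z) ≡ ℤ→ℚ y ℚ.* ℤ→ℚ z
ℤ→ℚ-* y z = sym (cong₂ ℚ._*_ (ℤ→ℚ≡ y) (ℤ→ℚ≡ z))

ℕ→ℚ-+ : ∀ m n → ℕ→ℚ (m ℕ.+ n) ≡ ℕ→ℚ m ℚ.+ ℕ→ℚ n
ℕ→ℚ-+ m n = ℤ→ℚ-+ (+ m) (+ n)

ℕ→ℚ-* : ∀ m n → ℕ→ℚ (m ℕ.* n) ≡ ℕ→ℚ m ℚ.* ℕ→ℚ n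
ℕ→ℚ-* m n = trans (cong ℤ→ℚ (ℤₚ.pos-* m n)) (ℤ→ℚ-* (+ m) (+ n))

ℤ→ℚ-mono-≤ : ∀ {y z} → y ℤ.≤ z → ℤ→ℚ y ℚ.≤ ℤ→ℚ z
ℤ→ℚ-mono-≤ {y} {z} y≤z = subst₂ ℚ._≤_ (sym (ℤ→ℚ≡ y)) (sym (ℤ→ℚ≡ z))
  (ℚ.*≤* (ℤₚ.*-monoʳ-≤-nonNeg 1ℤ y≤z))

ℤ→ℚ-mono-< : ∀ {y z} → y ℤ.< z → ℤ→ℚ y ℚ.< ℤ→ℚ z
ℤ→ℚ-mono-< {y} {z} y<z = subst₂ ℚ._<_ (sym (ℤ→ℚ≡ y)) (sym (ℤ→ℚ≡ z))
  (ℚ.*<* (ℤₚ.*-monoʳ-<-pos 1ℤ y<z))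

ℕ→ℚ-mono-≤ : ∀ {m n} → m ℕ.≤ n → ℕ→ℚ m ℚ.≤ ℕ→ℚ n
ℕ→ℚ-mono-≤ m≤n = ℤ→ℚ-mono-≤ (ℤ.+≤+ m≤n)

ℕ→ℚ-mono-< : ∀ {m n} → m ℕ.< n → ℕ→ℚ m ℚ.< ℕ→ℚ n
ℕ→ℚ-mono-< m<n = ℤ→ℚ-mono-< (ℤ.+<+ m<n)

ℕ→ℚ-cancel-< : ∀ {m n} → ℕ→ℚ m ℚ.< ℕ→ℚ n → m ℕ.< n
ℕ→ℚ-cancel-< m<n = ℕₚ.≰⇒> λ n≤m → <⇒≱ m<n (ℕ→ℚ-mono-≤ n≤m)

0≤ℕ→ℚ : ∀ n → 0ℚ ℚ.≤ ℕ→ℚ n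
0≤ℕ→ℚ n = ℕ→ℚ-mono-≤ {0} {n} z≤n

-- An inequality p ≤ q is often proved by writing q - p as a sum of products of
-- nonnegative terms; the ring solver checks such a certificate.

p≤q⇒0≤q-p : ∀ {p q} → p ℚ.≤ q → 0ℚ ℚ.≤ q ℚ.- p
p≤q⇒0≤q-p {p} {q} p≤q = subst (ℚ._≤ q ℚ.- p) (ℚₚ.+-inverseʳ p) (ℚₚ.+-monoˡ-≤ (ℚ.- p) p≤q)

p<q⇒0<q-p : ∀ {p q} → p ℚ.< q → 0ℚ ℚ.< q ℚ.- p
p<q⇒0<q-p {p} {q} p<q = subst (ℚ._< q ℚ.- p) (ℚₚ.+-inverseʳ p) (ℚₚ.+-monoˡ-< (ℚ.- p) p<q)

p-q+q : ∀ p q → q ℚ.- p ℚ.+ p ≡ q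
p-q+q = solve-∀ ℚ-ring

0≤q-p⇒p≤q : ∀ {p q} → 0ℚ ℚ.≤ q ℚ.- p → p ℚ.≤ q
0≤q-p⇒p≤q {p} {q} 0≤ = subst₂ ℚ._≤_ (ℚₚ.+-identityˡ p) (p-q+q p q) (ℚₚ.+-monoˡ-≤ p 0≤)

0<q-p⇒p<q : ∀ {p q} → 0ℚ ℚ.< q ℚ.- p → p ℚ.< q
0<q-p⇒p<q {p} {q} 0< = subst₂ ℚ._<_ (ℚₚ.+-identityˡ p) (p-q+q p q) (ℚₚ.+-monoˡ-< p 0<)

0≤*0≤ : ∀ {p q} → 0ℚ ℚ.≤ p → 0ℚ ℚ.≤ q → 0ℚ ℚ.≤ p ℚ.* q
0≤*0≤ {p} {q} 0≤p 0≤q = subst (ℚ._≤ p ℚ.* q) (ℚₚ.*-zeroʳ p)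
  (ℚₚ.*-monoˡ-≤-nonNeg p {{ℚ.nonNegative 0≤p}} 0≤q)

0<*0< : ∀ {p q} → 0ℚ ℚ.< p → 0ℚ ℚ.< q → 0ℚ ℚ.< p ℚ.* q
0<*0< {p} {q} 0<p 0<q = subst (ℚ._< p ℚ.* q) (ℚₚ.*-zeroʳ p)
  (ℚₚ.*-monoʳ-<-pos p {{ℚ.positive 0<p}} 0<q)

*-mono-≤ : ∀ {p q r s} → 0ℚ ℚ.≤ p → 0ℚ ℚ.≤ s → p ℚ.≤ q → r ℚ.≤ s → p ℚ.* r ℚ.≤ q ℚ.* s
*-mono-≤ {p} {q} {r} {s} 0≤p 0≤s p≤q r≤s = ℚₚ.≤-trans
  (ℚₚ.*-monoˡ-≤-nonNeg p {{ℚ.nonNegative 0≤p}} r≤s)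
  (ℚₚ.*-monoʳ-≤-nonNeg s {{ℚ.nonNegative 0≤s}} p≤q)

*-cancelʳ-<0 : ∀ {p q r} → 0ℚ ℚ.< r → p ℚ.* r ℚ.< q ℚ.* r → p ℚ.< q
*-cancelʳ-<0 {r = r} 0<r = ℚₚ.*-cancelʳ-<-nonNeg r {{ℚ.nonNegative (ℚₚ.<⇒≤ 0<r)}}

-- The map t ↦ t * c is monotone or antitone, so a bound that holds at both ends
-- of an interval holds inside it.
affine-< : ∀ {s a b c t} → a ℚ.< t → t ℚ.< b →
           s ℚ.< a ℚ.* c → s ℚ.< b ℚ.* c → s ℚ.< t ℚ.* c
affine-< {c = c} a<t t<b s<ac s<bc with ℚₚ.≤-total 0ℚ c
... | inj₁ 0≤c = ℚₚ.<-≤-trans s<ac (ℚₚ.*-monoʳ-≤-nonNeg c {{ℚ.nonNegative 0≤c}} (ℚₚ.<⇒≤ a<t))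
... | inj₂ c≤0 = ℚₚ.<-≤-trans s<bc (ℚₚ.*-monoʳ-≤-nonPos c {{ℚ.nonPositive c≤0}} (ℚₚ.<⇒≤ t<b))

affine-> : ∀ {s a b c t} → a ℚ.< t → t ℚ.< b →
           a ℚ.* c ℚ.< s → b ℚ.* c ℚ.< s → t ℚ.* c ℚ.< s
affine-> {c = c} a<t t<b ac<s bc<s with ℚₚ.≤-total 0ℚ c
... | inj₁ 0≤c = ℚₚ.≤-<-trans (ℚₚ.*-monoʳ-≤-nonNeg c {{ℚ.nonNegative 0≤c}} (ℚₚ.<⇒≤ t<b)) bc<s
... | inj₂ c≤0 = ℚₚ.≤-<-trans (ℚₚ.*-monoʳ-≤-nonPos c {{ℚ.nonPositive c≤0}} (ℚₚ.<⇒≤ a<t)) ac<s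

-- Powers of rationals

^-nonNeg : ∀ {p} n → 0ℚ ℚ.≤ p → 0ℚ ℚ.≤ p ^ n
^-nonNeg zero    0≤p = ℕ→ℚ-mono-≤ {0} {1} z≤n
^-nonNeg (suc n) 0≤p = 0≤*0≤ 0≤p (^-nonNeg n 0≤p)

^-monoˡ-≤ : ∀ {p q} n → 0ℚ ℚ.≤ p → p ℚ.≤ q → p ^ n ℚ.≤ q ^ n
^-monoˡ-≤ zero    0≤p p≤q = ℚₚ.≤-refl
^-monoˡ-≤ (suc n) 0≤p p≤q = *-mono-≤ 0≤p (^-nonNeg n (ℚₚ.≤-trans 0≤p p≤q)) p≤q (^-monoˡ-≤ n 0≤p p≤q)

2^+ : ∀ n → 2^ (+ n) ≡ ℕ→ℚ (2 ℕ.^ n)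
2^+ zero    = refl
2^+ (suc n) = trans (cong (ℕ→ℚ 2 ℚ.*_) (2^+ n)) (sym (ℕ→ℚ-* 2 (2 ℕ.^ n)))

0<½ : 0ℚ ℚ.< ½
0<½ = ℚₚ.positive⁻¹ ½

0<2^ : ∀ z → 0ℚ ℚ.< 2^ z
0<2^ (+ n) = subst (0ℚ ℚ.<_) (sym (2^+ n)) (ℕ→ℚ-mono-< (ℕₚ.m^n>0 2 n))
0<2^ -[1+ n ] = go (suc n)
  where
  go : ∀ n → 0ℚ ℚ.< ½ ^ n
  go zero    = ℚₚ.positive⁻¹ 1ℚ
  go (suc n) = 0<*0< 0<½ (go n)

2^-suc : ∀ z → 2^ (ℤ.suc z) ≡ ℕ→ℚ 2 ℚ.* 2^ z
2^-suc (+ n)          = refl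
2^-suc -[1+ zero ]    = refl
2^-suc -[1+ suc n ]   = sym (trans (sym (ℚₚ.*-assoc (ℕ→ℚ 2) ½ (½ ^ suc n))) (ℚₚ.*-identityˡ (½ ^ suc n)))

2^-mono-+ : ∀ z n → 2^ z ℚ.≤ 2^ (+ n ℤ.+ z)
2^-mono-+ z zero    = ℚₚ.≤-reflexive (cong 2^_ (sym (ℤₚ.+-identityˡ z)))
2^-mono-+ z (suc n) = ℚₚ.≤-trans (2^-mono-+ z n) (begin
  2^ (+ n ℤ.+ z)                ≡⟨ ℚₚ.*-identityˡ _ ⟨
  1ℚ ℚ.* 2^ (+ n ℤ.+ z)         ≤⟨ ℚₚ.*-monoʳ-≤-nonNeg (2^ (+ n ℤ.+ z)) {{ℚ.nonNegative (ℚₚ.<⇒≤ (0<2^ (+ n ℤ.+ z)))}} (ℕ→ℚ-mono-≤ {1} {2} (s≤s z≤n)) ⟩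
  ℕ→ℚ 2 ℚ.* 2^ (+ n ℤ.+ z)      ≡⟨ 2^-suc (+ n ℤ.+ z) ⟨
  2^ (ℤ.suc (+ n ℤ.+ z))        ≡⟨ cong 2^_ (ℤₚ.+-assoc 1ℤ (+ n) z) ⟨
  2^ (+ suc n ℤ.+ z)            ∎)
  where open ℚₚ.≤-Reasoning

2^-mono-≤ : ∀ {y z} → y ℤ.≤ z → 2^ y ℚ.≤ 2^ z
2^-mono-≤ {y} {z} y≤z = subst (λ w → 2^ y ℚ.≤ 2^ w)
  (trans (cong (ℤ._+ y) (ℤₚ.0≤i⇒+∣i∣≡i (ℤₚ.i≤j⇒0≤j-i y≤z))) (trans (ℤₚ.+-assoc z (ℤ.- y) y) (trans (cong (ℤ._+_ z) (ℤₚ.+-inverseˡ y)) (ℤₚ.+-identityʳ z))))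
  (2^-mono-+ y ℤ.∣ z ℤ.- y ∣)

2^-* : ∀ z d .{{_ : NonZero d}} → (2^ z) ^ d ≡ 2^ (z ℤ.* + d)
2^-* (+ n)    d       = trans (^-assocʳ (ℕ→ℚ 2) n d) (cong 2^_ (ℤₚ.pos-* n d))
2^-* -[1+ n ] (suc d) = ^-assocʳ ½ (suc n) (suc d)

2^-inverse : ∀ z → 2^ z ℚ.* 2^ (ℤ.- z) ≡ 1ℚ
2^-inverse (+ zero)  = refl
2^-inverse (+ suc n) = go n
  where
  regroup : ∀ a b c d → (a ℚ.* b) ℚ.* (c ℚ.* d) ≡ (a ℚ.* c) ℚ.* (b ℚ.* d)
  regroup = solve-∀ ℚ-ring
  go : ∀ n → 2^ (+ suc n) ℚ.* 2^ -[1+ n ] ≡ 1ℚ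
  go zero    = refl
  go (suc n) = trans (regroup (ℕ→ℚ 2) (2^ (+ suc n)) ½ (2^ -[1+ n ])) (trans (ℚₚ.*-identityˡ _) (go n))
2^-inverse -[1+ n ]  = trans (ℚₚ.*-comm _ (2^ (+ suc n))) (2^-inverse (+ suc n))

-- Floor, ceiling and rounding

floor-unique : ∀ {p z} → ℤ→ℚ z ℚ.≤ p → p ℚ.< ℤ→ℚ (ℤ.suc z) → floor p ≡ z
floor-unique {p@(mkℚ n d-1 _)} {z} z≤p p<z+1 = ℤₚ.≤-antisym (below lt₁) (below lt₂)
  where
  d = + suc d-1
  f = n ℤ./ d
  below : ∀ {y z} → y ℤ.< ℤ.suc z → y ℤ.≤ z
  below {y} {z} y<sz = subst (y ℤ.≤_) (ℤₚ.pred-suc z) (ℤₚ.i<j⇒i≤pred[j] y<sz)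
  zd≤n : z ℤ.* d ℤ.≤ n
  zd≤n = subst (z ℤ.* d ℤ.≤_) (ℤₚ.*-identityʳ n) (ℚₚ.drop-*≤* (subst (ℚ._≤ p) (ℤ→ℚ≡ z) z≤p))
  n<[z+1]d : n ℤ.< ℤ.suc z ℤ.* d
  n<[z+1]d = subst (ℤ._< ℤ.suc z ℤ.* d) (ℤₚ.*-identityʳ n) (ℚₚ.drop-*<* (subst (p ℚ.<_) (ℤ→ℚ≡ (ℤ.suc z)) p<z+1))
  lt₁ : f ℤ.< ℤ.suc z
  lt₁ = ℤₚ.*-cancelʳ-<-nonNeg d (ℤₚ.≤-<-trans (ℤ.[n/d]*d≤n n d) n<[z+1]d)
  lt₂ : z ℤ.< ℤ.suc f
  lt₂ = ℤₚ.*-cancelʳ-<-nonNeg d (ℤₚ.≤-<-trans zd≤n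
    (subst (λ g → n ℤ.< ℤ.suc g ℤ.* d) (sym (ℤ.div-pos-is-/ℕ n (suc d-1))) (ℤ.n<s[n/ℕd]*d n (suc d-1))))

ceiling-unfold : ∀ p → ceiling p ≡ ℤ.- floor (ℚ.- p)
ceiling-unfold (mkℚ _ _ _) = refl

ℤ→ℚ-neg : ∀ z → ℤ→ℚ (ℤ.- z) ≡ ℚ.- ℤ→ℚ z
ℤ→ℚ-neg z = trans (unique (ℤ→ℚ (ℤ.- z)) (ℤ→ℚ z)) (trans
  (cong (ℚ._- ℤ→ℚ z) (trans (sym (ℤ→ℚ-+ (ℤ.- z) z)) (cong ℤ→ℚ (ℤₚ.+-inverseˡ z))))
  (ℚₚ.+-identityˡ (ℚ.- ℤ→ℚ z)))
  where
  unique : ∀ p q → p ≡ (p ℚ.+ q) ℚ.- q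
  unique = solve-∀ ℚ-ring

ceiling-unique : ∀ {p z} → p ℚ.≤ ℤ→ℚ z → ℤ→ℚ z ℚ.< p ℚ.+ 1ℚ → ceiling p ≡ z
ceiling-unique {p} {z} p≤z z<p+1 = trans (ceiling-unfold p) (trans (cong ℤ.-_ (floor-unique {ℚ.- p} {ℤ.- z}
    (subst (ℚ._≤ ℚ.- p) (sym (ℤ→ℚ-neg z)) (ℚₚ.neg-antimono-≤ p≤z))
    (subst₂ ℚ._<_ (shift p) (trans (cong (1ℚ ℚ.+_) (sym (ℤ→ℚ-neg z))) (sym (ℤ→ℚ-+ 1ℤ (ℤ.- z))))
      (ℚₚ.+-monoʳ-< 1ℚ (ℚₚ.neg-antimono-< z<p+1)))))
  (ℤₚ.neg-involutive z))
  where
  shift : ∀ p → 1ℚ ℚ.+ ℚ.- (p ℚ.+ 1ℚ) ≡ ℚ.- p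
  shift = solve-∀ ℚ-ring

-- Logarithms and products of cuts

ℤ→ℚ≤⇒ : ∀ {z c} → ℤ→ℚ z ℚ.≤ c → z ℤ.* + ↧ₙ c ℤ.≤ ↥ c
ℤ→ℚ≤⇒ {z} {c@(mkℚ _ _ _)} z≤c = subst (z ℤ.* + ↧ₙ c ℤ.≤_) (ℤₚ.*-identityʳ (↥ c))
  (ℚₚ.drop-*≤* (subst (ℚ._≤ c) (ℤ→ℚ≡ z) z≤c))

≤ℤ→ℚ⇒ : ∀ {z c} → c ℚ.≤ ℤ→ℚ z → ↥ c ℤ.≤ z ℤ.* + ↧ₙ c
≤ℤ→ℚ⇒ {z} {c@(mkℚ _ _ _)} c≤z = subst (ℤ._≤ z ℤ.* + ↧ₙ c) (ℤₚ.*-identityʳ (↥ c))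
  (ℚₚ.drop-*≤* (subst (c ℚ.≤_) (ℤ→ℚ≡ z) c≤z))

2^-^ : ∀ z (c : ℚ) → (2^ z) ^ ↧ₙ c ≡ 2^ (z ℤ.* + ↧ₙ c)
2^-^ z (mkℚ _ d-1 _) = 2^-* z (suc d-1)

-- If q < log a in the sense of 2 ^ num < a ^ den, and a ≤ 2 ^ z, then q < z;
-- and dually.
2^<^⇒< : ∀ {a z c} → 0ℚ ℚ.≤ a → a ℚ.≤ 2^ z → 2^ (↥ c) ℚ.< a ^ ↧ₙ c → c ℚ.< ℤ→ℚ z
2^<^⇒< {a} {z} {c} 0≤a a≤2^z lt = ℚₚ.≰⇒> λ z≤c → <⇒≱ lt (begin
  a ^ ↧ₙ c                ≤⟨ ^-monoˡ-≤ (↧ₙ c) 0≤a a≤2^z ⟩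
  (2^ z) ^ ↧ₙ c           ≡⟨ 2^-^ z c ⟩
  2^ (z ℤ.* + ↧ₙ c)       ≤⟨ 2^-mono-≤ (ℤ→ℚ≤⇒ {z} {c} z≤c) ⟩
  2^ (↥ c)                ∎)
  where open ℚₚ.≤-Reasoning

^<2^⇒< : ∀ {b z c} → 2^ z ℚ.≤ b → b ^ ↧ₙ c ℚ.< 2^ (↥ c) → ℤ→ℚ z ℚ.< c
^<2^⇒< {b} {z} {c} 2^z≤b lt = ℚₚ.≰⇒> λ c≤z → <⇒≱ lt (begin
  2^ (↥ c)                ≤⟨ 2^-mono-≤ (≤ℤ→ℚ⇒ {z} {c} c≤z) ⟩
  2^ (z ℤ.* + ↧ₙ c)       ≡⟨ 2^-^ z c ⟨
  (2^ z) ^ ↧ₙ c           ≤⟨ ^-monoˡ-≤ (↧ₙ c) (ℚₚ.<⇒≤ (0<2^ z)) 2^z≤b ⟩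
  b ^ ↧ₙ c                ∎)
  where open ℚₚ.≤-Reasoning

L-log-intro : ∀ {x a} z → L x a → 2^ z ℚ.< a → L (log x) (ℤ→ℚ z)
L-log-intro {x} {a} z La 2^z<a = a , ℚₚ.<-trans (0<2^ z) 2^z<a , La ,
  subst₂ ℚ._<_ (cong 2^_ (sym (↥-ℤ→ℚ z))) (trans (sym (ℚₚ.*-identityʳ a)) (cong (a ^_) (sym (↧ₙ-ℤ→ℚ z)))) 2^z<a

U-log-intro : ∀ {x b} z → U x b → b ℚ.< 2^ z → U (log x) (ℤ→ℚ z)
U-log-intro {x} {b} z Ub b<2^z = b , Ub ,
  subst₂ ℚ._<_ (trans (sym (ℚₚ.*-identityʳ b)) (cong (b ^_) (sym (↧ₙ-ℤ→ℚ z)))) (cong 2^_ (sym (↥-ℤ→ℚ z))) b<2^z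

L-log-fromℕ : ∀ {W} m {c} → W ℕ.≤ 2 ℕ.^ m → L (log (fromℕ W)) c → c ℚ.< ℕ→ℚ m
L-log-fromℕ {W} m {c} W≤2^m (a , 0<a , a<W , lt) = 2^<^⇒< {a} {+ m} {c} (ℚₚ.<⇒≤ 0<a)
  (ℚₚ.≤-trans (ℚₚ.<⇒≤ a<W) (subst (ℕ→ℚ W ℚ.≤_) (sym (2^+ m)) (ℕ→ℚ-mono-≤ {W} {2 ℕ.^ m} W≤2^m))) lt

U-log-fromℕ : ∀ {W} n {c} → 2 ℕ.^ n ℕ.≤ W → U (log (fromℕ W)) c → ℕ→ℚ n ℚ.< c
U-log-fromℕ {W} n {c} 2^n≤W (b , W<b , lt) = ^<2^⇒< {b} {+ n} {c}
  (ℚₚ.≤-trans (subst (ℚ._≤ ℕ→ℚ W) (sym (2^+ n)) (ℕ→ℚ-mono-≤ {2 ℕ.^ n} {W} 2^n≤W)) (ℚₚ.<⇒≤ W<b)) lt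

L-log-fromℕ-intro : ∀ {W} m → 2 ℕ.^ m ℕ.< W → L (log (fromℕ W)) (ℕ→ℚ m)
L-log-fromℕ-intro {W} m 2^m<W = L-log-intro {fromℕ W} {proj₁ between} (+ m)
  (proj₂ (proj₂ between)) (proj₁ (proj₂ between))
  where
  between : ∃[ a ] 2^ (+ m) ℚ.< a × a ℚ.< ℕ→ℚ W
  between = ℚₚ.<-dense (subst (ℚ._< ℕ→ℚ W) (sym (2^+ m)) (ℕ→ℚ-mono-< {2 ℕ.^ m} {W} 2^m<W))

U-log-fromℕ-intro : ∀ {W} m → W ℕ.< 2 ℕ.^ m → U (log (fromℕ W)) (ℕ→ℚ m)
U-log-fromℕ-intro {W} m W<2^m = U-log-intro {fromℕ W} {proj₁ between} (+ m)
  (proj₁ (proj₂ between)) (proj₂ (proj₂ between))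
  where
  between : ∃[ b ] ℕ→ℚ W ℚ.< b × b ℚ.< 2^ (+ m)
  between = ℚₚ.<-dense (subst (ℕ→ℚ W ℚ.<_) (sym (2^+ m)) (ℕ→ℚ-mono-< {W} {2 ℕ.^ m} W<2^m))

L<U : ∀ {x l u} → IsReal x → L x l → U x u → l ℚ.< u
L<U {x} {l} {u} real Ll Uu with ℚₚ.<-cmp l u
... | tri< l<u _ _    = l<u
... | tri≈ _ refl _   = contradiction (Ll , Uu) (IsReal.disjoint real)
... | tri> _ _ u<l    = contradiction (Ll , IsReal.U-upper real u<l Uu) (IsReal.disjoint real)

-- In a product with a rational constant, affine-< and affine-> replace the two
-- rational bounds on the constant by the constant itself.

L-2* : ∀ {x q} → L (fromℕ 2 *ʳ x) q → ∃[ c ] L x c × q ℚ.< ℕ→ℚ 2 ℚ.* c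
L-2* (a , b , c , d , a<2 , 2<b , Lc , Ud , q<ac , _ , q<bc , _) = c , Lc , affine-< {c = c} a<2 2<b q<ac q<bc

U-2* : ∀ {x q} → U (fromℕ 2 *ʳ x) q → ∃[ d ] U x d × ℕ→ℚ 2 ℚ.* d ℚ.< q
U-2* (a , b , c , d , a<2 , 2<b , Lc , Ud , _ , ad<q , _ , bd<q) = d , Ud , affine-> {c = d} a<2 2<b ad<q bd<q

-- For p ≥ 0 the upper bound r of t decides; for p ≤ 0 the product is at most 0.
scale-≤ʳ : ∀ {p t r s} → 0ℚ ℚ.≤ s → (∀ {d} → U t d → 0ℚ ℚ.≤ d) → (∀ {c} → L t c → c ℚ.≤ r) →
           p ℚ.* r ℚ.≤ s → fromℚ p *ʳ t ≤ʳ fromℚ s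
scale-≤ʳ {p} {t} {r} {s} 0≤s U≥0 L≤r pr≤s
  (q , s<q , a , b , c , d , a<p , p<b , Lc , Ud , q<ac , q<ad , q<bc , q<bd)
  with ℚₚ.≤-total 0ℚ p
... | inj₁ 0≤p = <⇒≱ (affine-< {c = c} a<p p<b q<ac q<bc) (begin
  p ℚ.* c   ≤⟨ ℚₚ.*-monoˡ-≤-nonNeg p {{ℚ.nonNegative 0≤p}} (L≤r Lc) ⟩
  p ℚ.* r   ≤⟨ pr≤s ⟩
  s         ≤⟨ ℚₚ.<⇒≤ s<q ⟩
  q         ∎)
  where open ℚₚ.≤-Reasoning
... | inj₂ p≤0 = <⇒≱ (affine-< {c = d} a<p p<b q<ad q<bd) (begin
  p ℚ.* d   ≤⟨ ℚₚ.*-monoʳ-≤-nonNeg d {{ℚ.nonNegative (U≥0 Ud)}} p≤0 ⟩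
  0ℚ ℚ.* d  ≡⟨ ℚₚ.*-zeroˡ d ⟩
  0ℚ        ≤⟨ 0≤s ⟩
  s         ≤⟨ ℚₚ.<⇒≤ s<q ⟩
  q         ∎)
  where open ℚₚ.≤-Reasoning

≤ʳ-scale : ∀ {p t s} → (∀ {d} → U t d → s ℚ.≤ p ℚ.* d) → fromℚ s ≤ʳ fromℚ p *ʳ t
≤ʳ-scale {p} {t} {s} s≤pU
  (q , (a , b , c , d , a<p , p<b , Lc , Ud , _ , ad<q , _ , bd<q) , q<s) =
  <⇒≱ (ℚₚ.<-trans (affine-> {c = d} a<p p<b ad<q bd<q) q<s) (s≤pU Ud)

-- The reciprocal of 2ε and its approximation k

U-⁻¹-pos : ∀ {x d} → U (x ⁻¹) d → 0ℚ ℚ.< d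
U-⁻¹-pos {x} {d} (l , 0<l , Ll , 1<dl) = *-cancelʳ-<0 {r = l} 0<l
  (ℚₚ.<-trans (subst (ℚ._< 1ℚ) (sym (ℚₚ.*-zeroˡ l)) (ℚₚ.positive⁻¹ 1ℚ)) 1<dl)

-- x - p < x, so every upper bound of 1 / (x - p) bounds 1 / x as well.
L-⁻¹-≤ : ∀ {x p r c} → 0ℚ ℚ.< p → (x -ʳ fromℚ p) ⁻¹ ≤ʳ fromℚ r → L (x ⁻¹) c → c ℚ.≤ r
L-⁻¹-≤ {x} {p} {r} {c} 0<p inv≤r (u , Uu , cu<1) = ℚₚ.≮⇒≥ λ r<c →
  inv≤r (c , r<c , u , (u , 0ℚ , Uu , 0<p , sym (ℚₚ.+-identityʳ u)) , cu<1)

module _ {ε : Cut} (real : IsReal ε) (0<ε : fromℕ 0 <ʳ ε) where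

  open IsReal real

  private
    l : ℚ
    l = proj₁ 0<ε
    0<l : 0ℚ ℚ.< l
    0<l = proj₁ (proj₂ 0<ε)
    Ll : L ε l
    Ll = proj₂ (proj₂ 0<ε)

  U-pos : ∀ {u} → U ε u → 0ℚ ℚ.< u
  U-pos Uu = ℚₚ.<-trans 0<l (L<U real Ll Uu)

  -- The factor 4 instead of 2 leaves room for the strict inequalities in the
  -- definition of the product.
  U-2*-intro : ∀ {u} → U ε u → U (fromℕ 2 *ʳ ε) (ℕ→ℚ 4 ℚ.* u)
  U-2*-intro {u} Uu = 1ℚ , ℕ→ℚ 3 , l , u , ℕ→ℚ-mono-< {1} {2} (s≤s (s≤s z≤n)) , ℕ→ℚ-mono-< {2} {3} (s≤s (s≤s (s≤s z≤n))) , Ll , Uu ,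
    bound 1 (s≤s (s≤s z≤n)) l≤u , bound 1 (s≤s (s≤s z≤n)) ℚₚ.≤-refl ,
    bound 3 (s≤s (s≤s (s≤s (s≤s z≤n)))) l≤u , bound 3 (s≤s (s≤s (s≤s (s≤s z≤n)))) ℚₚ.≤-refl
    where
    l≤u : l ℚ.≤ u
    l≤u = ℚₚ.<⇒≤ (L<U real Ll Uu)
    bound : ∀ m {v} → m ℕ.< 4 → v ℚ.≤ u → ℕ→ℚ m ℚ.* v ℚ.< ℕ→ℚ 4 ℚ.* u
    bound m {v} m<4 v≤u = ℚₚ.≤-<-trans
      (ℚₚ.*-monoˡ-≤-nonNeg (ℕ→ℚ m) {{ℚ.nonNegative (0≤ℕ→ℚ m)}} v≤u)
      (ℚₚ.*-monoˡ-<-pos u {{ℚ.positive (U-pos Uu)}} (ℕ→ℚ-mono-< {m} {4} m<4))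

  L-⁻¹-≤4* : ∀ {p r a} → 0ℚ ℚ.< p → (fromℕ 2 *ʳ ε -ʳ fromℚ p) ⁻¹ ≤ʳ fromℚ r → L (ε ⁻¹) a → a ℚ.≤ ℕ→ℚ 4 ℚ.* r
  L-⁻¹-≤4* {p} {r} {a} 0<p inv≤r (u , Uu , au<1) = subst (ℚ._≤ ℕ→ℚ 4 ℚ.* r) (four a)
    (ℚₚ.*-monoˡ-≤-nonNeg (ℕ→ℚ 4) {¼ ℚ.* a} {r} (L-⁻¹-≤ {fromℕ 2 *ʳ ε} {p} {r} {¼ ℚ.* a} 0<p inv≤r
      (ℕ→ℚ 4 ℚ.* u , U-2*-intro Uu , subst (ℚ._< 1ℚ) (quarter a u) au<1)))
    where
    ¼ = + 1 ℚ./ 4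
    regroup : ∀ a b c d → (c ℚ.* d) ℚ.* (a ℚ.* b) ≡ (c ℚ.* a) ℚ.* (d ℚ.* b)
    regroup = solve-∀ ℚ-ring
    four : ∀ a → ℕ→ℚ 4 ℚ.* (¼ ℚ.* a) ≡ a
    four a = trans (sym (ℚₚ.*-assoc (ℕ→ℚ 4) ¼ a)) (ℚₚ.*-identityˡ a)
    quarter : ∀ a u → a ℚ.* u ≡ (¼ ℚ.* a) ℚ.* (ℕ→ℚ 4 ℚ.* u)
    quarter a u = trans (sym (ℚₚ.*-identityˡ (a ℚ.* u))) (regroup a u ¼ (ℕ→ℚ 4))

  module _ {W : ℕ} {υ : ℤ} (υ-ceil : IsCeiling υ (log (ε ⁻¹ *ʳ log (fromℕ W)))) where

    -- 2 ^ (- υ) is at most a 2 / j fraction of ε for j < log W.  Otherwise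
    -- (log W) / ε would exceed 2 ^ (υ + 1), and the integer υ + 1 would lie
    -- between υ and log ((log W) / ε).
    2^-υ-small : ∀ {j m e} → 2 ℕ.^ j ℕ.< W → W ℕ.< 2 ℕ.^ m → U ε e →
                 ℕ→ℚ j ℚ.* 2^ (ℤ.- υ) ℚ.≤ ℕ→ℚ 2 ℚ.* e
    2^-υ-small {j} {m} {e} 2^j<W W<2^m Ue = ℚₚ.≮⇒≥ λ 2e<jp → absurd 2e<jp
      where
      absurd : ¬ (ℕ→ℚ 2 ℚ.* e ℚ.< ℕ→ℚ j ℚ.* 2^ (ℤ.- υ))
      absurd 2e<jp = proj₂ υ-ceil
        (ℤ→ℚ (ℤ.suc υ) , ℤ→ℚ-mono-< {υ} {ℤ.suc υ} (ℤₚ.suc[i]≤j⇒i<j ℤₚ.≤-refl) ,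
         L-log-intro {ε ⁻¹ *ʳ log (fromℕ W)} {a} (ℤ.suc υ)
           (1/e , b , ℕ→ℚ j , ℕ→ℚ m , (e′ , Ue′ , 1/e*e′<1) , (l , 0<l , Ll , 1<bl) ,
            L-log-fromℕ-intro j 2^j<W , U-log-fromℕ-intro m W<2^m ,
            a<j/e ,
            ℚₚ.<-≤-trans a<j/e (*-mono-≤ 0≤1/e (0≤ℕ→ℚ m) ℚₚ.≤-refl j≤m) ,
            ℚₚ.<-≤-trans a<j/e (*-mono-≤ 0≤1/e (0≤ℕ→ℚ j) 1/e≤b ℚₚ.≤-refl) ,
            ℚₚ.<-≤-trans a<j/e (*-mono-≤ 0≤1/e (0≤ℕ→ℚ m) 1/e≤b j≤m))
           2^<a)
        where
        instance
          e-pos : ℚ.Positive e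
          e-pos = ℚ.positive (U-pos Ue)
          l-pos : ℚ.Positive l
          l-pos = ℚ.positive 0<l
          e-nonZero : ℚ.NonZero e
          e-nonZero = ℚₚ.pos⇒nonZero e
          l-nonZero : ℚ.NonZero l
          l-nonZero = ℚₚ.pos⇒nonZero l
        -- The rationals 1/e < 1/ε < b and j < log W < m enclose the two factors.
        1/e 1/l b e′ : ℚ
        1/e = ℚ.1/ e
        1/l = ℚ.1/ l
        b   = 1/l ℚ.+ 1/e
        e′  = proj₁ (U-open Ue)
        e′<e : e′ ℚ.< e
        e′<e = proj₁ (proj₂ (U-open Ue))
        Ue′ : U ε e′
        Ue′ = proj₂ (proj₂ (U-open Ue))
        0<1/e : 0ℚ ℚ.< 1/e
        0<1/e = ℚₚ.positive⁻¹ 1/e {{ℚₚ.1/pos⇒pos e}}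
        0≤1/e : 0ℚ ℚ.≤ 1/e
        0≤1/e = ℚₚ.<⇒≤ 0<1/e
        0<1/l : 0ℚ ℚ.< 1/l
        0<1/l = ℚₚ.positive⁻¹ 1/l {{ℚₚ.1/pos⇒pos l}}
        1/e≤b : 1/e ℚ.≤ b
        1/e≤b = subst (ℚ._≤ b) (ℚₚ.+-identityˡ 1/e) (ℚₚ.+-monoˡ-≤ 1/e (ℚₚ.<⇒≤ 0<1/l))
        1<bl : 1ℚ ℚ.< b ℚ.* l
        1<bl = subst₂ ℚ._<_ (ℚₚ.*-inverseˡ l) refl
          (ℚₚ.*-monoˡ-<-pos l (subst (ℚ._< b) (ℚₚ.+-identityʳ 1/l) (ℚₚ.+-monoʳ-< 1/l 0<1/e)))
        1/e*e′<1 : 1/e ℚ.* e′ ℚ.< 1ℚ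
        1/e*e′<1 = subst (1/e ℚ.* e′ ℚ.<_) (ℚₚ.*-inverseˡ e) (ℚₚ.*-monoʳ-<-pos 1/e {{ℚ.positive 0<1/e}} e′<e)
        j≤m : ℕ→ℚ j ℚ.≤ ℕ→ℚ m
        j≤m = ℕ→ℚ-mono-≤ {j} {m} (ℕₚ.≮⇒≥ λ m<j → ℕₚ.<-irrefl refl
          (ℕₚ.<-trans W<2^m (ℕₚ.≤-<-trans (ℕₚ.^-monoʳ-≤ 2 (ℕₚ.<⇒≤ m<j)) 2^j<W)))
        regroup : ∀ t p e → (t ℚ.* p) ℚ.* e ≡ (t ℚ.* e) ℚ.* p
        regroup = solve-∀ ℚ-ring
        2^υ = 2^ υ
        -- This is 2 e < j 2^(-υ) multiplied by 2^υ.
        scaled : 2^ (ℤ.suc υ) ℚ.* e ℚ.< ℕ→ℚ j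
        scaled = subst₂ ℚ._<_
          (trans (regroup (ℕ→ℚ 2) e 2^υ) (cong (ℚ._* e) (sym (2^-suc υ))))
          (trans (ℚₚ.*-assoc (ℕ→ℚ j) (2^ (ℤ.- υ)) 2^υ)
            (trans (cong (ℕ→ℚ j ℚ.*_) (trans (ℚₚ.*-comm (2^ (ℤ.- υ)) 2^υ) (2^-inverse υ))) (ℚₚ.*-identityʳ (ℕ→ℚ j))))
          (ℚₚ.*-monoˡ-<-pos 2^υ {{ℚ.positive (0<2^ υ)}} 2e<jp)
        2^<j/e : 2^ (ℤ.suc υ) ℚ.< 1/e ℚ.* ℕ→ℚ j
        2^<j/e = subst₂ ℚ._<_
          (trans (ℚₚ.*-assoc (2^ (ℤ.suc υ)) e 1/e) (trans (cong (2^ (ℤ.suc υ) ℚ.*_) (ℚₚ.*-inverseʳ e)) (ℚₚ.*-identityʳ _)))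
          (ℚₚ.*-comm (ℕ→ℚ j) 1/e)
          (ℚₚ.*-monoˡ-<-pos 1/e {{ℚ.positive 0<1/e}} scaled)
        -- A rational a with 2^(υ + 1) < a < (log W) / ε.
        between = ℚₚ.<-dense 2^<j/e
        a : ℚ
        a = proj₁ between
        2^<a : 2^ (ℤ.suc υ) ℚ.< a
        2^<a = proj₁ (proj₂ between)
        a<j/e : a ℚ.< 1/e ℚ.* ℕ→ℚ j
        a<j/e = proj₂ (proj₂ between)

    -- 2 ^ υ = O(r log W) for every upper bound r of 1 / (2ε - p), such as r = k.
    2^υ-bound : ∀ {m r p} → 1 ℕ.≤ W → W ℕ.≤ 2 ℕ.^ m → 0ℚ ℚ.< p →
                (fromℕ 2 *ʳ ε -ʳ fromℚ p) ⁻¹ ≤ʳ fromℚ r →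
                2^ (υ ℤ.- 1ℤ) ℚ.< (ℕ→ℚ 4 ℚ.* r) ℚ.* ℕ→ℚ m
    2^υ-bound {m} {r} {p} 1≤W W≤2^m 0<p inv≤r with proj₁ υ-ceil
    ... | q , υ-1<q , a , 0<a , (a₀ , b₀ , c₀ , d₀ , La₀ , Ub₀ , Lc₀ , Ud₀ , a<ac , a<ad , _ , _) , 2^<a^ = begin-strict
      2^ (υ ℤ.- 1ℤ)                  <⟨ ℚₚ.≰⇒> (λ a≤ → ℚₚ.<-asym υ-1<q (2^<^⇒< {a} {υ ℤ.- 1ℤ} {q} (ℚₚ.<⇒≤ 0<a) a≤ 2^<a^)) ⟩
      a                              <⟨ a<ac ⟩
      a₀ ℚ.* c₀                      ≤⟨ ℚₚ.*-monoˡ-≤-nonNeg a₀ {{ℚ.nonNegative (ℚₚ.<⇒≤ 0<a₀)}} (ℚₚ.<⇒≤ (L-log-fromℕ {W} m W≤2^m Lc₀)) ⟩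
      a₀ ℚ.* ℕ→ℚ m                   ≤⟨ ℚₚ.*-monoʳ-≤-nonNeg (ℕ→ℚ m) {{ℚ.nonNegative (0≤ℕ→ℚ m)}} (L-⁻¹-≤4* {p} {r} {a₀} 0<p inv≤r La₀) ⟩
      (ℕ→ℚ 4 ℚ.* r) ℚ.* ℕ→ℚ m        ∎
      where
      open ℚₚ.≤-Reasoning
      0<d₀ : 0ℚ ℚ.< d₀
      0<d₀ = U-log-fromℕ {W} 0 1≤W Ud₀
      -- The factors a₀ and c₀ cannot both be negative, since a₀ d₀ > a > 0.
      0<a₀ : 0ℚ ℚ.< a₀
      0<a₀ = *-cancelʳ-<0 {r = d₀} 0<d₀ (subst (ℚ._< a₀ ℚ.* d₀) (sym (ℚₚ.*-zeroˡ d₀)) (ℚₚ.<-trans 0<a a<ad))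

  -- If p is at most a 1 / (1 + j) fraction of 2ε and k < 1 / (2ε - p), then
  -- 1 / (2ε) ≥ k (1 - 1 / (1 + j)).
  U-⁻¹-≥ : ∀ {j k p d} → (∀ {e} → U ε e → ℕ→ℚ (suc j) ℚ.* p ℚ.≤ ℕ→ℚ 2 ℚ.* e) →
           fromℕ k <ʳ (fromℕ 2 *ʳ ε -ʳ fromℚ p) ⁻¹ →
           U ((fromℕ 2 *ʳ ε) ⁻¹) d →
           ℕ→ℚ k ℚ.* ℕ→ℚ j ℚ.≤ d ℚ.* ℕ→ℚ (suc j)
  U-⁻¹-≥ {j} {k} {p} {d} p-small (q , k<q , u , (a , b , Ua , -b<p , refl) , qu<1) Ud@(l₂ , 0<l₂ , Ll₂ , 1<dl₂)
    with L-2* {ε} Ll₂ | U-2* {ε} Ua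
  ... | e₁ , Le₁ , l₂<2e₁ | e₂ , Ue₂ , 2e₂<a = begin
    K ℚ.* J                       ≤⟨ ℚₚ.*-monoʳ-≤-nonNeg J {{ℚ.nonNegative (0≤ℕ→ℚ j)}} (ℚₚ.<⇒≤ k<q) ⟩
    q ℚ.* J                       ≡⟨ ℚₚ.*-identityʳ (q ℚ.* J) ⟨
    (q ℚ.* J) ℚ.* 1ℚ              ≤⟨ ℚₚ.*-monoˡ-≤-nonNeg (q ℚ.* J) {{ℚ.nonNegative (0≤*0≤ 0≤q (0≤ℕ→ℚ j))}} (ℚₚ.<⇒≤ 1<da) ⟩
    (q ℚ.* J) ℚ.* (d ℚ.* a)       ≡⟨ eq₁ q J d a ⟩
    (d ℚ.* q) ℚ.* (J ℚ.* a)       ≤⟨ ℚₚ.*-monoˡ-≤-nonNeg (d ℚ.* q) {{ℚ.nonNegative (0≤*0≤ (ℚₚ.<⇒≤ 0<d) 0≤q)}} ja≤[1+j]u ⟩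
    (d ℚ.* q) ℚ.* (J⁺ ℚ.* (a ℚ.+ b))  ≡⟨ eq₂ q J⁺ d (a ℚ.+ b) ⟩
    (d ℚ.* J⁺) ℚ.* (q ℚ.* (a ℚ.+ b))  ≤⟨ ℚₚ.*-monoˡ-≤-nonNeg (d ℚ.* J⁺) {{ℚ.nonNegative (0≤*0≤ (ℚₚ.<⇒≤ 0<d) (0≤ℕ→ℚ (suc j)))}} (ℚₚ.<⇒≤ qu<1) ⟩
    (d ℚ.* J⁺) ℚ.* 1ℚ             ≡⟨ ℚₚ.*-identityʳ (d ℚ.* J⁺) ⟩
    d ℚ.* J⁺                      ∎
    where
    open ℚₚ.≤-Reasoning
    K J J⁺ : ℚ
    K = ℕ→ℚ k
    J = ℕ→ℚ j
    J⁺ = ℕ→ℚ (suc j)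
    eq₁ : ∀ q J d a → (q ℚ.* J) ℚ.* (d ℚ.* a) ≡ (d ℚ.* q) ℚ.* (J ℚ.* a)
    eq₁ = solve-∀ ℚ-ring
    eq₂ : ∀ q J d u → (d ℚ.* q) ℚ.* (J ℚ.* u) ≡ (d ℚ.* J) ℚ.* (q ℚ.* u)
    eq₂ = solve-∀ ℚ-ring
    0<d : 0ℚ ℚ.< d
    0<d = U-⁻¹-pos {fromℕ 2 *ʳ ε} Ud
    0≤q : 0ℚ ℚ.≤ q
    0≤q = ℚₚ.≤-trans (0≤ℕ→ℚ k) (ℚₚ.<⇒≤ k<q)
    l₂<a : l₂ ℚ.< a
    l₂<a = ℚₚ.<-trans l₂<2e₁ (ℚₚ.<-trans (ℚₚ.*-monoʳ-<-pos (ℕ→ℚ 2) (L<U real Le₁ Ue₂)) 2e₂<a)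
    1<da : 1ℚ ℚ.< d ℚ.* a
    1<da = ℚₚ.<-trans 1<dl₂ (ℚₚ.*-monoʳ-<-pos d {{ℚ.positive 0<d}} l₂<a)
    certificate : ∀ J a b p → (a ℚ.- (1ℚ ℚ.+ J) ℚ.* p) ℚ.+ (1ℚ ℚ.+ J) ℚ.* (p ℚ.- ℚ.- b) ≡ (1ℚ ℚ.+ J) ℚ.* (a ℚ.+ b) ℚ.- J ℚ.* a
    certificate = solve-∀ ℚ-ring
    J⁺≡ : J⁺ ≡ 1ℚ ℚ.+ J
    J⁺≡ = ℕ→ℚ-+ 1 j
    ja≤[1+j]u : J ℚ.* a ℚ.≤ J⁺ ℚ.* (a ℚ.+ b)
    ja≤[1+j]u = subst (λ x → J ℚ.* a ℚ.≤ x ℚ.* (a ℚ.+ b)) (sym J⁺≡) (0≤q-p⇒p≤q (subst (0ℚ ℚ.≤_) (certificate J a b p)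
      (ℚₚ.+-mono-≤ {0ℚ} {_} {0ℚ}
        (p≤q⇒0≤q-p (ℚₚ.≤-trans (subst (λ x → x ℚ.* p ℚ.≤ ℕ→ℚ 2 ℚ.* e₂) J⁺≡ (p-small Ue₂)) (ℚₚ.<⇒≤ 2e₂<a)))
        (0≤*0≤ (subst (0ℚ ℚ.≤_) J⁺≡ (0≤ℕ→ℚ (suc j))) (p≤q⇒0≤q-p (ℚₚ.<⇒≤ -b<p))))))

toℕ/R≤1 : ∀ {a} R .{{_ : NonZero R}} → a ℕ.≤ R → + a ℚ./ R ℚ.≤ 1ℚ
toℕ/R≤1 {a} R@(suc n) a≤R = ℚₚ.toℚᵘ-cancel-≤ (ℚᵘₚ.≤-respˡ-≃ (ℚᵘₚ.≃-sym (ℚₚ.toℚᵘ-fromℚᵘ (ℚᵘ.mkℚᵘ (+ a) n)))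
  (ℚᵘ.*≤* (subst₂ ℤ._≤_ (sym (ℤₚ.*-identityʳ (+ a))) (sym (ℤₚ.*-identityˡ (+ R))) (ℤ.+≤+ a≤R))))

R/R≡1 : ∀ R .{{_ : NonZero R}} → + R ℚ./ R ≡ 1ℚ
R/R≡1 R@(suc n) = ℚₚ.fromℚᵘ-cong {ℚᵘ.mkℚᵘ (+ R) n} {ℚᵘ.mkℚᵘ 1ℤ 0} (ℚᵘ.*≡* (ℤₚ.*-comm (+ R) 1ℤ))

½<1 : ½ ℚ.< 1ℚ
½<1 = ℚ.*<* (ℤ.+<+ (s≤s (s≤s z≤n)))

Round-1 : ∀ u → Round (+ u) 1ℚ ≡ 1ℚ
Round-1 u = trans (cong (λ z → ℤ→ℚ z ℚ.* 2^ (ℤ.- + u)) ceiling≡)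
  (trans (cong (ℚ._* 2^ (ℤ.- + u)) (sym (2^+ u))) (2^-inverse (+ u)))
  where
  V : ℚ
  V = ℕ→ℚ (2 ℕ.^ u)
  shift₁ : ∀ p h → p ℚ.- (p ℚ.* 1ℚ ℚ.- h) ≡ h
  shift₁ = solve-∀ ℚ-ring
  shift₂ : ∀ p h → (p ℚ.* 1ℚ ℚ.- h) ℚ.+ 1ℚ ℚ.- p ≡ 1ℚ ℚ.- h
  shift₂ = solve-∀ ℚ-ring
  ceiling≡ : ceiling (2^ (+ u) ℚ.* 1ℚ ℚ.- ½) ≡ + (2 ℕ.^ u)
  ceiling≡ = trans (cong (λ v → ceiling (v ℚ.* 1ℚ ℚ.- ½)) (2^+ u))
    (ceiling-unique {V ℚ.* 1ℚ ℚ.- ½} {+ (2 ℕ.^ u)}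
      (0≤q-p⇒p≤q (subst (0ℚ ℚ.≤_) (sym (shift₁ V ½)) (ℚₚ.<⇒≤ 0<½)))
      (0<q-p⇒p<q (subst (0ℚ ℚ.<_) (sym (shift₂ V ½)) (p<q⇒0<q-p ½<1))))

-- For a negative exponent the positive multiples of 2 ^ (- υ) are at least 2,
-- and ties go down.
Round-neg : ∀ u {z} → 0ℚ ℚ.≤ z → z ℚ.≤ 1ℚ → Round -[1+ u ] z ≡ 0ℚ
Round-neg u {z} 0≤z z≤1 = trans (cong (λ c → ℤ→ℚ c ℚ.* 2^ (ℤ.- -[1+ u ])) ceiling≡) (ℚₚ.*-zeroˡ (2^ (ℤ.- -[1+ u ])))
  where
  P : ℚ
  P = 2^ -[1+ u ]
  0≤P : 0ℚ ℚ.≤ P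
  0≤P = ℚₚ.<⇒≤ (0<2^ -[1+ u ])
  Pz≤½ : P ℚ.* z ℚ.≤ ½
  Pz≤½ = *-mono-≤ {P} {½} {z} {1ℚ} 0≤P (0≤ℕ→ℚ 1) (2^-mono-≤ { -[1+ u ]} { -[1+ 0 ]} (ℤ.-≤- z≤n)) z≤1
  shift₁ : ∀ p h → 0ℚ ℚ.- (p ℚ.- h) ≡ h ℚ.- p
  shift₁ = solve-∀ ℚ-ring
  shift₂ : ∀ p h → p ℚ.- h ℚ.+ 1ℚ ℚ.- 0ℚ ≡ (1ℚ ℚ.- h) ℚ.+ p
  shift₂ = solve-∀ ℚ-ring
  ceiling≡ : ceiling (P ℚ.* z ℚ.- ½) ≡ 0ℤ
  ceiling≡ = ceiling-unique {P ℚ.* z ℚ.- ½} {0ℤ}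
    (0≤q-p⇒p≤q (subst (0ℚ ℚ.≤_) (sym (shift₁ (P ℚ.* z) ½)) (p≤q⇒0≤q-p Pz≤½)))
    (0<q-p⇒p<q (subst (0ℚ ℚ.<_) (sym (shift₂ (P ℚ.* z) ½)) (ℚₚ.+-mono-<-≤ {0ℚ} {_} {0ℚ} (p<q⇒0<q-p ½<1) (0≤*0≤ 0≤P 0≤z))))

-- Reachable states and widths of the variables

-- The number of ones in a bit array.
ones : ∀ {n} → Vec Bool n → ℕ
ones []       = 0
ones (x ∷ xs) = bit x ℕ.+ ones xs

bit≤1 : ∀ x → bit x ℕ.≤ 1
bit≤1 false = z≤n
bit≤1 true  = s≤s z≤n

ones≤n : ∀ {n} (xs : Vec Bool n) → ones xs ℕ.≤ n
ones≤n []       = z≤n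
ones≤n (x ∷ xs) = ℕₚ.+-mono-≤ (bit≤1 x) (ones≤n xs)

ones-replicate-false : ∀ n → ones (replicate n false) ≡ 0
ones-replicate-false zero    = refl
ones-replicate-false (suc n) = ones-replicate-false n

ones-all : ∀ {n} (xs : Vec Bool n) → (∀ j → lookup xs j ≡ true) → ones xs ≡ n
ones-all []       _   = refl
ones-all (x ∷ xs) all = cong₂ ℕ._+_ (cong bit (all zero)) (ones-all xs (λ j → all (suc j)))

ones-update : ∀ {n} (xs : Vec Bool n) j v → ones (xs [ j ]≔ v) ℕ.+ bit (lookup xs j) ≡ ones xs ℕ.+ bit v
ones-update (x ∷ xs) zero    v = swap (bit v) (ones xs) (bit x)
  where
  swap : ∀ a b c → a ℕ.+ b ℕ.+ c ≡ c ℕ.+ b ℕ.+ a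
  swap a b c = trans (ℕₚ.+-comm (a ℕ.+ b) c) (trans (cong (c ℕ.+_) (ℕₚ.+-comm a b)) (sym (ℕₚ.+-assoc c b a)))
ones-update (x ∷ xs) (suc j) v = trans (ℕₚ.+-assoc (bit x) _ _)
  (trans (cong (bit x ℕ.+_) (ones-update xs j v)) (sym (ℕₚ.+-assoc (bit x) _ _)))

module Widths (W R : ℕ) .{{_ : NonZero R}} (υ : ℤ) (k : ℕ) .{{_ : NonZero k}}
              (0<block : 0 ℕ.< Algorithm.block W R υ k) where

  open Algorithm W R υ k

  -- The element as rounded by add.
  rounded : Fin (suc R) → ℚ
  rounded x = Round υ (+ toℕ x ℚ./ R)

  -- The bit that is stored when x completes a block.
  overflow : State → Fin (suc R) → Bool
  overflow s x = does (ℕ→ℚ block ℚₚ.≤? y s ℚ.+ rounded x)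

  -- The two branches of add: for the last element of a block and for the others.

  wrap stay : State → Fin (suc R) → State
  wrap s x = state (if overflow s x then y s ℚ.- ℕ→ℚ block ℚ.+ rounded x else y s ℚ.+ rounded x)
                   (B s ℤ.- + bit (lookup (b s) (i s)) ℤ.+ + bit (overflow s x))
                   (next (i s)) 0 (b s [ i s ]≔ overflow s x)
  stay s x = state (y s ℚ.+ rounded x) (B s) (i s) (suc (m s)) (b s)

  add-wrap : ∀ s x → suc (m s) ≡ block → add s x ≡ wrap s x
  add-wrap s x eq = cong (λ t → if t then wrap s x else stay s x)
    (dec-true (m s ℕₚ.≟ block ℕ.∸ 1) (cong (ℕ._∸ 1) eq))

  add-stay : ∀ s x → suc (m s) ≢ block → add s x ≡ stay s x
  add-stay s x neq = cong (λ t → if t then wrap s x else stay s x)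
    (dec-false (m s ℕₚ.≟ block ℕ.∸ 1) λ eq → neq (trans (cong suc eq) (ℕₚ.suc-pred block {{ℕ.>-nonZero 0<block}})))

  run-invariant : (P : State → Set) → P initial → (∀ s x → P s → P (add s x)) → ∀ xs → P (run xs)
  run-invariant P P₀ P-add = go initial P₀
    where
    go : ∀ s → P s → ∀ xs → P (foldl add s xs)
    go s Ps []       = Ps
    go s Ps (x ∷ xs) = go (add s x) (P-add s x Ps) xs

  add-preserves : (P : State → Set) →
    (∀ s x → suc (m s) ≡ block → P s → P (wrap s x)) →
    (∀ s x → suc (m s) ≢ block → P s → P (stay s x)) →
    ∀ s x → P s → P (add s x)
  add-preserves P P-wrap P-stay s x Ps = go (suc (m s) ℕₚ.≟ block)
    where
    go : Dec (suc (m s) ≡ block) → P (add s x)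
    go (yes eq) = subst P (sym (add-wrap s x eq)) (P-wrap s x eq Ps)
    go (no neq) = subst P (sym (add-stay s x neq)) (P-stay s x neq Ps)

  m<block : ∀ xs → m (run xs) ℕ.< block
  m<block = run-invariant (λ s → m s ℕ.< block) 0<block
    (add-preserves (λ s → m s ℕ.< block) (λ _ _ _ _ → 0<block) (λ _ _ neq m< → ℕₚ.≤∧≢⇒< m< neq))

  B≡ones : ∀ xs → B (run xs) ≡ + ones (b (run xs))
  B≡ones = run-invariant Counts (cong +_ (sym (ones-replicate-false k)))
    (add-preserves Counts (λ s x _ → counts-wrap s x) (λ _ _ _ c → c))
    where
    Counts : State → Set
    Counts s = B s ≡ + ones (b s)
    cancel : ∀ {c c′ l o} → c′ ℕ.+ l ≡ c ℕ.+ o → + c ℤ.- + l ℤ.+ + o ≡ + c′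
    cancel {c} {c′} {l} {o} eq = begin-equality
      + c ℤ.- + l ℤ.+ + o        ≡⟨ ℤₚ.+-assoc (+ c) (ℤ.- + l) (+ o) ⟩
      + c ℤ.+ (ℤ.- + l ℤ.+ + o)  ≡⟨ cong (ℤ._+_ (+ c)) (ℤₚ.+-comm (ℤ.- + l) (+ o)) ⟩
      + c ℤ.+ (+ o ℤ.- + l)      ≡⟨ ℤₚ.+-assoc (+ c) (+ o) (ℤ.- + l) ⟨
      + (c ℕ.+ o) ℤ.- + l        ≡⟨ cong (λ a → + a ℤ.- + l) eq ⟨
      + c′ ℤ.+ + l ℤ.- + l       ≡⟨ ℤₚ.+-assoc (+ c′) (+ l) (ℤ.- + l) ⟩
      + c′ ℤ.+ (+ l ℤ.- + l)     ≡⟨ cong (ℤ._+_ (+ c′)) (ℤₚ.+-inverseʳ (+ l)) ⟩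
      + c′ ℤ.+ 0ℤ                ≡⟨ ℤₚ.+-identityʳ (+ c′) ⟩
      + c′                       ∎
      where open ℤₚ.≤-Reasoning
    counts-wrap : ∀ s x → Counts s → Counts (wrap s x)
    counts-wrap s x eq = trans
      (cong (λ c → c ℤ.- + bit (lookup (b s) (i s)) ℤ.+ + bit (overflow s x)) eq)
      (cancel (ones-update (b s) (i s) (overflow s x)))

  -- The maximal element of a stream.
  top : Fin (suc R)
  top = Fin.fromℕ R

  -- The state after j full blocks and r further elements of a stream of maximal
  -- elements.  If maximal elements are rounded to 1, every completed block has
  -- set its bit.
  record At (j r : ℕ) (s : State) : Set where
    field
      m≡ : m s ≡ r
      i≡ : toℕ (i s) ≡ j ℕ.% k
      y≡ : rounded top ≡ 1ℚ → y s ≡ ℕ→ℚ r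
      b≡ : rounded top ≡ 1ℚ → ∀ l → toℕ l ℕ.< j → lookup (b s) l ≡ true

  at-initial : At 0 0 initial
  at-initial = record
    { m≡ = refl
    ; i≡ = trans (Finₚ.toℕ-fromℕ< (ℕ.>-nonZero⁻¹ k)) (sym (m<n⇒m%n≡m (ℕ.>-nonZero⁻¹ k)))
    ; y≡ = λ _ → refl
    ; b≡ = λ _ _ () }

  at-stay : ∀ {j r s} → At j r s → suc r ℕ.< block → At j (suc r) (add s top)
  at-stay {j} {r} {s} at r< = subst (At j (suc r))
    (sym (add-stay s top λ eq → ℕₚ.<⇒≢ r< (trans (cong suc (sym m≡)) eq)))
    (record
      { m≡ = cong suc m≡
      ; i≡ = i≡
      ; y≡ = λ one → trans (cong₂ ℚ._+_ (y≡ one) one) (trans (ℚₚ.+-comm (ℕ→ℚ r) 1ℚ) (sym (ℕ→ℚ-+ 1 r)))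
      ; b≡ = b≡ })
    where open At at

  at-wrap : ∀ {j r s} → At j r s → suc r ≡ block → j ℕ.< k → At (suc j) 0 (add s top)
  at-wrap {j} {r} {s} at r≡ j<k = subst (At (suc j) 0)
    (sym (add-wrap s top (trans (cong suc m≡) r≡)))
    (record
      { m≡ = refl
      ; i≡ = trans (Finₚ.toℕ-fromℕ< (m%n<n (suc (toℕ (i s))) k)) (cong (λ l → suc l ℕ.% k) i≡j)
      ; y≡ = λ one → trans (cong (λ o → if o then y s ℚ.- ℕ→ℚ block ℚ.+ rounded top else y s ℚ.+ rounded top) (over one))
               (trans (cong₂ (λ p q → p ℚ.- ℕ→ℚ block ℚ.+ q) (y≡ one) one)
                 (trans (cong (λ a → ℕ→ℚ r ℚ.- a ℚ.+ 1ℚ) block≡) (cancel (ℕ→ℚ r))))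
      ; b≡ = λ one l l≤j → bits one l l≤j (l Finₚ.≟ i s) })
    where
    open At at
    i≡j : toℕ (i s) ≡ j
    i≡j = trans i≡ (m<n⇒m%n≡m j<k)
    block≡ : ℕ→ℚ block ≡ ℕ→ℚ r ℚ.+ 1ℚ
    block≡ = trans (cong ℕ→ℚ (trans (sym r≡) (ℕₚ.+-comm 1 r))) (ℕ→ℚ-+ r 1)
    cancel : ∀ p → p ℚ.- (p ℚ.+ 1ℚ) ℚ.+ 1ℚ ≡ 0ℚ
    cancel = solve-∀ ℚ-ring
    over : rounded top ≡ 1ℚ → overflow s top ≡ true
    over one = dec-true (ℕ→ℚ block ℚₚ.≤? y s ℚ.+ rounded top)
      (ℚₚ.≤-reflexive (trans block≡ (cong₂ ℚ._+_ (sym (y≡ one)) (sym one))))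
    bits : rounded top ≡ 1ℚ → ∀ l → toℕ l ℕ.< suc j → Dec (l ≡ i s) →
           lookup (b s [ i s ]≔ overflow s top) l ≡ true
    bits one l l≤j (yes refl) = trans (Vecₚ.lookup∘updateAt (i s) (b s)) (over one)
    bits one l l≤j (no l≢i)   = trans (Vecₚ.lookup∘update′ l≢i (b s) (overflow s top))
      (b≡ one l (ℕₚ.≤∧≢⇒< (ℕ.s≤s⁻¹ l≤j) λ l≡j → l≢i (Finₚ.toℕ-injective (trans l≡j (sym i≡j)))))

  -- Some reachable state satisfies P.
  Reachable : (State → Set) → Set
  Reachable P = ∃[ xs ] P (run xs)

  reachable-add : ∀ (P Q : State → Set) → (∀ {s} → P s → Q (add s top)) → Reachable P → Reachable Q
  reachable-add P Q P⇒Q (xs , Ps) = xs ∷ʳ top , subst Q (sym (foldl-∷ʳ add initial top xs)) (P⇒Q Ps)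

  reach-inside : ∀ {j} → Reachable (At j 0) → ∀ r → r ℕ.< block → Reachable (At j r)
  reach-inside     reach zero    _  = reach
  reach-inside {j} reach (suc r) r< = reachable-add (At j r) (At j (suc r)) (λ {s} at → at-stay {s = s} at r<) (reach-inside reach r (ℕₚ.<-trans (ℕₚ.n<1+n r) r<))

  last<block : ℕ.pred block ℕ.< block
  last<block = ℕₚ.≤-reflexive (ℕₚ.suc-pred block {{ℕ.>-nonZero 0<block}})

  reach-block : ∀ j → j ℕ.≤ k → Reachable (At j 0)
  reach-block zero    _   = [] , at-initial
  reach-block (suc j) j<k = reachable-add (At j (ℕ.pred block)) (At (suc j) 0)
    (λ {s} at → at-wrap {s = s} at (ℕₚ.suc-pred block {{ℕ.>-nonZero 0<block}}) j<k)
    (reach-inside (reach-block j (ℕₚ.<⇒≤ j<k)) (ℕ.pred block) last<block)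

  -- A variable that ranges over 0, ..., a - 1 and attains a - 1 has width ⌈log₂ a⌉.
  width-bounded : ∀ (var : State → ℤ) {a} →
    (∀ xs → 0ℤ ℤ.≤ var (run xs) × var (run xs) ℤ.< + a) →
    (∃[ xs ] + a ℤ.≤ ℤ.suc (var (run xs))) →
    IsWidth var ⌈log₂ a ⌉
  width-bounded var {a} bounded (xs , attained) =
    (λ ys → proj₁ (bounded ys) , ℤₚ.<-≤-trans (proj₂ (bounded ys)) (ℤ.+≤+ (m≤2^⌈log₂m⌉ a))) ,
    λ w fits → ⌈log₂⌉-least w (ℤₚ.drop‿+≤+ (ℤₚ.≤-trans attained (ℤₚ.i<j⇒suc[i]≤j (proj₂ (fits xs)))))

  m-width : IsWidth (λ s → + m s) ⌈log₂ block ⌉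
  m-width = width-bounded (λ s → + m s) (λ xs → ℤ.+≤+ z≤n , ℤ.+<+ (m<block xs))
    (let xs , at = reach-inside (reach-block 0 z≤n) (ℕ.pred block) last<block in
     xs , ℤ.+≤+ (ℕₚ.≤-reflexive (trans (sym (ℕₚ.suc-pred block {{ℕ.>-nonZero 0<block}})) (cong suc (sym (At.m≡ at))))))

  i-width : IsWidth (λ s → + toℕ (i s)) ⌈log₂ k ⌉
  i-width = width-bounded (λ s → + toℕ (i s)) (λ xs → ℤ.+≤+ z≤n , ℤ.+<+ (Finₚ.toℕ<n (i (run xs))))
    (let xs , at = reach-block (ℕ.pred k) (ℕₚ.pred[n]≤n {k}) in
     xs , ℤ.+≤+ (ℕₚ.≤-reflexive (trans (sym (ℕₚ.suc-pred k)) (cong suc (sym (trans (At.i≡ at) (m<n⇒m%n≡m pred<)))))))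
    where
    pred< : ℕ.pred k ℕ.< k
    pred< = ℕₚ.≤-reflexive (ℕₚ.suc-pred k)

  B-width-full : rounded top ≡ 1ℚ → IsWidth B ⌈log₂ suc k ⌉
  B-width-full one = width-bounded B
    (λ xs → subst (λ c → 0ℤ ℤ.≤ c × c ℤ.< + suc k) (sym (B≡ones xs)) (ℤ.+≤+ z≤n , ℤ.+<+ (s≤s (ones≤n (b (run xs))))))
    (let xs , at = reach-block k ℕₚ.≤-refl in
     xs , ℤₚ.≤-reflexive (cong ℤ.suc (sym (trans (B≡ones xs)
       (cong +_ (ones-all (b (run xs)) λ l → At.b≡ at one l (Finₚ.toℕ<n l)))))))

  B-width-empty : (∀ x → rounded x ≡ 0ℚ) → IsWidth B 0
  B-width-empty zeros = (λ xs → subst (λ c → 0ℤ ℤ.≤ c × c ℤ.< 1ℤ) (sym (B≡0 xs)) (ℤ.+≤+ z≤n , ℤ.+<+ (s≤s z≤n))) , λ _ _ → z≤n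
    where
    Empty : State → Set
    Empty s = y s ≡ 0ℚ × b s ≡ replicate k false
    y+≡0 : ∀ s x → y s ≡ 0ℚ → y s ℚ.+ rounded x ≡ 0ℚ
    y+≡0 s x y≡0 = cong₂ ℚ._+_ y≡0 (zeros x)
    no-overflow : ∀ s x → y s ≡ 0ℚ → overflow s x ≡ false
    no-overflow s x y≡0 = dec-false (ℕ→ℚ block ℚₚ.≤? y s ℚ.+ rounded x)
      λ block≤ → <⇒≱ (ℕ→ℚ-mono-< {0} {block} 0<block) (subst (ℕ→ℚ block ℚ.≤_) (y+≡0 s x y≡0) block≤)
    empty-wrap : ∀ s x → Empty s → Empty (wrap s x)
    empty-wrap s x (y≡0 , b≡) =
      trans (cong (λ o → if o then y s ℚ.- ℕ→ℚ block ℚ.+ rounded x else y s ℚ.+ rounded x) (no-overflow s x y≡0)) (y+≡0 s x y≡0) ,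
      trans (cong₂ (λ v o → v [ i s ]≔ o) b≡ (no-overflow s x y≡0))
        (trans (cong (replicate k false [ i s ]≔_) (sym (Vecₚ.lookup-replicate (i s) false))) (Vecₚ.[]≔-lookup (replicate k false) (i s)))
    empty : ∀ xs → Empty (run xs)
    empty = run-invariant Empty (refl , refl)
      (add-preserves Empty (λ s x _ → empty-wrap s x) (λ s x _ (y≡0 , b≡) → y+≡0 s x y≡0 , b≡))
    B≡0 : ∀ xs → B (run xs) ≡ 0ℤ
    B≡0 xs = trans (B≡ones xs) (cong +_ (trans (cong ones (proj₂ (empty xs))) (ones-replicate-false k)))

  B-width : ∃[ w ] IsWidth B w × w ℕ.≤ suc ⌈log₂ k ⌉
  B-width = go υ refl
    where
    ⌈log₂⌉-suc : ⌈log₂ suc k ⌉ ℕ.≤ suc ⌈log₂ k ⌉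
    ⌈log₂⌉-suc = ⌈log₂⌉-least (suc ⌈log₂ k ⌉) (subst (suc k ℕ.≤_) (cong (2 ℕ.^ ⌈log₂ k ⌉ ℕ.+_) (sym (ℕₚ.+-identityʳ _)))
      (ℕₚ.+-mono-≤ (ℕₚ.m^n>0 2 ⌈log₂ k ⌉) (m≤2^⌈log₂m⌉ k)))
    go : ∀ z → υ ≡ z → ∃[ w ] IsWidth B w × w ℕ.≤ suc ⌈log₂ k ⌉
    go (+ u)    υ≡ = ⌈log₂ suc k ⌉ , B-width-full (trans
      (cong₂ Round υ≡ (trans (cong (λ a → + a ℚ./ R) (Finₚ.toℕ-fromℕ R)) (R/R≡1 R))) (Round-1 u)) , ⌈log₂⌉-suc
    go -[1+ u ] υ≡ = 0 , B-width-empty (λ x → trans (cong (λ z → Round z (+ toℕ x ℚ./ R)) υ≡)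
      (Round-neg u (ℚₚ.nonNegative⁻¹ _ {{ℚₚ.normalize-nonNeg (toℕ x) R}}) (toℕ/R≤1 R (ℕ.s≤s⁻¹ (Finₚ.toℕ<n x))))) , z≤n

  -- The memory, with w the width of B.
  memory : ∃[ w ] w ℕ.≤ suc ⌈log₂ k ⌉ × RequiresBits
    ((suc ⌈log₂ block ⌉ ℕ.+ ℤ.∣ υ ℤ.⊔ 0ℤ ∣) ℕ.+ ⌈log₂ block ⌉ ℕ.+ ⌈log₂ k ⌉ ℕ.+ w ℕ.+ k)
  memory = let w , isWidth , w≤ = B-width in
    w , w≤ , ⌈log₂ block ⌉ , ⌈log₂ k ⌉ , w , m-width , i-width , isWidth ,
    cong (λ a → (a ℕ.+ fractionalBits) ℕ.+ ⌈log₂ block ⌉ ℕ.+ ⌈log₂ k ⌉ ℕ.+ w ℕ.+ k)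
      (sym (⌈log₂2*n⌉≡1+⌈log₂n⌉ block {{ℕ.>-nonZero 0<block}}))

-- The memory compared with the target

-- A positive δ is at least 1 / (1 + N) for some N; the denominator of δ is
-- such a number.
archimedean : ∀ {δ} → 0ℚ ℚ.< δ → ∃[ N ] 1ℚ ℚ.≤ δ ℚ.* (1ℚ ℚ.+ ℕ→ℚ N)
archimedean {mkℚ (+ zero)  d _} (ℚ.*<* (ℤ.+<+ ()))
archimedean {mkℚ -[1+ _ ]  d _} (ℚ.*<* ())
archimedean {δ@(mkℚ (+ suc a) d _)} _ = d , (begin
  1ℚ                         ≡⟨ ℚₚ.*-inverseˡ D ⟨
  ℚ.1/ D ℚ.* D               ≤⟨ ℚₚ.*-monoʳ-≤-nonNeg D {ℚ.1/ D} {δ} (ℚ.*≤* (ℤₚ.*-monoʳ-≤-nonNeg (+ suc d) {1ℤ} {+ suc a} (ℤ.+≤+ (s≤s z≤n)))) ⟩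
  δ ℚ.* D                    ≡⟨ cong (δ ℚ.*_) (ℤ→ℚ≡ (+ suc d)) ⟨
  δ ℚ.* ℕ→ℚ (suc d)          ≡⟨ cong (δ ℚ.*_) (ℕ→ℚ-+ 1 d) ⟩
  δ ℚ.* (1ℚ ℚ.+ ℕ→ℚ d)       ∎)
  where
  open ℚₚ.≤-Reasoning
  D : ℚ
  D = mkℚ (+ suc d) 0 (Coprimality.sym (Coprimality.1-coprimeTo (suc d)))

0<1+ : ∀ {n} → 0ℚ ℚ.≤ n → 0ℚ ℚ.< 1ℚ ℚ.+ n
0<1+ {n} 0≤n = ℚₚ.+-mono-<-≤ {0ℚ} {1ℚ} {0ℚ} {n} (ℚₚ.positive⁻¹ 1ℚ) 0≤n

-- These two lemmas replace δ by its lower bound 1 / (1 + n).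

lower-scaled : ∀ {δ n x m} → 0ℚ ℚ.≤ n → 1ℚ ℚ.≤ δ ℚ.* (1ℚ ℚ.+ n) → 0ℚ ℚ.≤ x →
  n ℚ.* x ℚ.≤ (1ℚ ℚ.+ n) ℚ.* m → (1ℚ ℚ.- δ) ℚ.* x ℚ.≤ m
lower-scaled {δ} {n} {x} {m} 0≤n 1≤δn 0≤x nx≤ = ℚₚ.*-cancelˡ-≤-pos (1ℚ ℚ.+ n) {{ℚ.positive (0<1+ 0≤n)}}
  (0≤q-p⇒p≤q (subst (0ℚ ℚ.≤_) (certificate n m x δ)
    (ℚₚ.+-mono-≤ {0ℚ} {_} {0ℚ} (p≤q⇒0≤q-p nx≤) (0≤*0≤ (p≤q⇒0≤q-p 1≤δn) 0≤x))))
  where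
  certificate : ∀ n m x δ →
    ((1ℚ ℚ.+ n) ℚ.* m ℚ.- n ℚ.* x) ℚ.+ (δ ℚ.* (1ℚ ℚ.+ n) ℚ.- 1ℚ) ℚ.* x ≡
    (1ℚ ℚ.+ n) ℚ.* m ℚ.- (1ℚ ℚ.+ n) ℚ.* ((1ℚ ℚ.- δ) ℚ.* x)
  certificate = solve-∀ ℚ-ring

upper-scaled : ∀ {δ n s y d m} → 0ℚ ℚ.≤ n → 0ℚ ℚ.< s → 0ℚ ℚ.≤ d → 1ℚ ℚ.≤ δ ℚ.* (1ℚ ℚ.+ n) →
  y ℚ.≤ d ℚ.* s → s ℚ.* ((1ℚ ℚ.+ n) ℚ.* m) ℚ.≤ (1ℚ ℚ.+ (1ℚ ℚ.+ n)) ℚ.* y → m ℚ.≤ (1ℚ ℚ.+ δ) ℚ.* d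
upper-scaled {δ} {n} {s} {y} {d} {m} 0≤n 0<s 0≤d 1≤δn y≤ds snm≤ =
  ℚₚ.*-cancelˡ-≤-pos (s ℚ.* (1ℚ ℚ.+ n)) {{ℚ.positive (0<*0< 0<s (0<1+ 0≤n))}}
  (0≤q-p⇒p≤q (subst (0ℚ ℚ.≤_) (certificate n m s y d δ)
    (ℚₚ.+-mono-≤ {0ℚ} {_} {0ℚ} (p≤q⇒0≤q-p snm≤)
      (ℚₚ.+-mono-≤ {0ℚ} {_} {0ℚ} (0≤*0≤ (ℚₚ.<⇒≤ (0<1+ (ℚₚ.<⇒≤ (0<1+ 0≤n)))) (p≤q⇒0≤q-p y≤ds))
        (0≤*0≤ (p≤q⇒0≤q-p 1≤δn) (0≤*0≤ 0≤d (ℚₚ.<⇒≤ 0<s)))))))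
  where
  certificate : ∀ n m s y d δ →
    ((1ℚ ℚ.+ (1ℚ ℚ.+ n)) ℚ.* y ℚ.- s ℚ.* ((1ℚ ℚ.+ n) ℚ.* m)) ℚ.+
    ((1ℚ ℚ.+ (1ℚ ℚ.+ n)) ℚ.* (d ℚ.* s ℚ.- y) ℚ.+ (δ ℚ.* (1ℚ ℚ.+ n) ℚ.- 1ℚ) ℚ.* (d ℚ.* s)) ≡
    s ℚ.* (1ℚ ℚ.+ n) ℚ.* ((1ℚ ℚ.+ δ) ℚ.* d) ℚ.- s ℚ.* (1ℚ ℚ.+ n) ℚ.* m
  certificate = solve-∀ ℚ-ring

ℕ→ℚ-suc-* : ∀ n m → ℕ→ℚ (suc n ℕ.* m) ≡ (1ℚ ℚ.+ ℕ→ℚ n) ℚ.* ℕ→ℚ m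
ℕ→ℚ-suc-* n m = trans (ℕ→ℚ-* (suc n) m) (cong (ℚ._* ℕ→ℚ m) (ℕ→ℚ-+ 1 n))

-- Here p, q, w and u are the widths of m, i, B and the fractional part of y.  The
-- number of blocks is k in the first lemma and k + 1 in the second.

memory-≥ : ∀ p u q w k n → n ℕ.≤ p ℕ.+ q →
  2 ℕ.* n ℕ.+ 1 ℕ.+ k ℕ.≤ ((suc p ℕ.+ u) ℕ.+ p ℕ.+ q ℕ.+ w ℕ.+ k) ℕ.+ q
memory-≥ p u q w k n n≤ = begin
  2 ℕ.* n ℕ.+ 1 ℕ.+ k                             ≤⟨ ℕₚ.+-monoˡ-≤ k (ℕₚ.+-monoˡ-≤ 1 (ℕₚ.*-monoʳ-≤ 2 n≤)) ⟩
  2 ℕ.* (p ℕ.+ q) ℕ.+ 1 ℕ.+ k                     ≤⟨ ℕₚ.m≤m+n _ (u ℕ.+ w) ⟩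
  2 ℕ.* (p ℕ.+ q) ℕ.+ 1 ℕ.+ k ℕ.+ (u ℕ.+ w)       ≡⟨ regroup p u q w k ⟩
  ((suc p ℕ.+ u) ℕ.+ p ℕ.+ q ℕ.+ w ℕ.+ k) ℕ.+ q   ∎
  where
  open ℕₚ.≤-Reasoning
  regroup : ∀ p u q w k → 2 ℕ.* (p ℕ.+ q) ℕ.+ 1 ℕ.+ k ℕ.+ (u ℕ.+ w) ≡ ((suc p ℕ.+ u) ℕ.+ p ℕ.+ q ℕ.+ w ℕ.+ k) ℕ.+ q
  regroup = ℕ-solver.solve-∀

memory-≤ : ∀ p u q w k n → p ℕ.+ q ℕ.≤ 2 ℕ.+ n → w ℕ.≤ suc q →
  (suc p ℕ.+ u) ℕ.+ p ℕ.+ q ℕ.+ w ℕ.+ suc k ℕ.≤ 2 ℕ.* n ℕ.+ 7 ℕ.+ u ℕ.+ k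
memory-≤ p u q w k n ≤n w≤ = begin
  (suc p ℕ.+ u) ℕ.+ p ℕ.+ q ℕ.+ w ℕ.+ suc k       ≤⟨ ℕₚ.+-monoˡ-≤ (suc k) (ℕₚ.+-monoʳ-≤ ((suc p ℕ.+ u) ℕ.+ p ℕ.+ q) w≤) ⟩
  (suc p ℕ.+ u) ℕ.+ p ℕ.+ q ℕ.+ suc q ℕ.+ suc k   ≡⟨ eq₁ p u q k ⟩
  2 ℕ.* (p ℕ.+ q) ℕ.+ (3 ℕ.+ u ℕ.+ k)             ≤⟨ ℕₚ.+-monoˡ-≤ (3 ℕ.+ u ℕ.+ k) (ℕₚ.*-monoʳ-≤ 2 ≤n) ⟩
  2 ℕ.* (2 ℕ.+ n) ℕ.+ (3 ℕ.+ u ℕ.+ k)             ≡⟨ eq₂ n u k ⟩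
  2 ℕ.* n ℕ.+ 7 ℕ.+ u ℕ.+ k                       ∎
  where
  open ℕₚ.≤-Reasoning
  eq₁ : ∀ p u q k → (suc p ℕ.+ u) ℕ.+ p ℕ.+ q ℕ.+ suc q ℕ.+ suc k ≡ 2 ℕ.* (p ℕ.+ q) ℕ.+ (3 ℕ.+ u ℕ.+ k)
  eq₁ = ℕ-solver.solve-∀
  eq₂ : ∀ n u k → 2 ℕ.* (2 ℕ.+ n) ℕ.+ (3 ℕ.+ u ℕ.+ k) ≡ 2 ℕ.* n ℕ.+ 7 ℕ.+ u ℕ.+ k
  eq₂ = ℕ-solver.solve-∀

-- For υ ≤ 0 there are no fractional bits, and the bound is trivial.
fractional-width : ∀ υ {K} → 1 ℕ.≤ K → 2^ (υ ℤ.- 1ℤ) ℚ.< ℕ→ℚ K → 2 ℕ.^ ℤ.∣ υ ℤ.⊔ 0ℤ ∣ ℕ.< 2 ℕ.* K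
fractional-width -[1+ u ]    {K} 1≤K _  = ℕₚ.+-mono-≤ 1≤K (ℕₚ.≤-trans 1≤K (ℕₚ.m≤m+n K 0))
fractional-width (+ zero)    {K} 1≤K _  = ℕₚ.+-mono-≤ 1≤K (ℕₚ.≤-trans 1≤K (ℕₚ.m≤m+n K 0))
fractional-width (+ suc u)   {K} 1≤K lt = ℕₚ.*-monoʳ-< 2 (ℕ→ℚ-cancel-< {2 ℕ.^ u} {K} (subst (ℚ._< ℕ→ℚ K) (2^+ u) lt))

-- The data of the theorem for a fixed W, with n the integer part of log W and
-- k + 1 blocks.
module Asymptotics
  {δ : ℚ} (N : ℕ) (1≤δN : 1ℚ ℚ.≤ δ ℚ.* (1ℚ ℚ.+ ℕ→ℚ N))
  {W R : ℕ} .{{_ : NonZero W}} .{{_ : NonZero R}}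
  {n : ℕ} (n≥ : threshold (suc N) ℕ.≤ n) (2^n≤W : 2 ℕ.^ n ℕ.≤ W) (W<2^1+n : W ℕ.< 2 ℕ.^ suc n)
  {ε : Cut} (real : IsReal ε) (0<ε : fromℕ 0 <ʳ ε)
  {υ : ℤ} (υ-ceil : IsCeiling υ (log (ε ⁻¹ *ʳ log (fromℕ W))))
  {k : ℕ} (k-ceil : IsCeiling (+ suc k) ((fromℕ 2 *ʳ ε -ʳ fromℚ (2^ (ℤ.- υ))) ⁻¹))
  (k∣W : suc k ∣ W)
  where

  open Algorithm W R υ (suc k) using (block; RequiresBits)

  target : Cut
  target = fromℕ 2 *ʳ log (fromℕ W) +ʳ (fromℕ 2 *ʳ ε) ⁻¹

  block*k≡W : block ℕ.* suc k ≡ W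
  block*k≡W = m/n*n≡m k∣W

  0<block : 0 ℕ.< block
  0<block = ℕₚ.n≢0⇒n>0 λ block≡0 →
    ℕ.≢-nonZero⁻¹ W (trans (sym block*k≡W) (cong (ℕ._* suc k) block≡0))

  p u q : ℕ
  p = ⌈log₂ block ⌉
  u = ℤ.∣ υ ℤ.⊔ 0ℤ ∣
  q = ⌈log₂ suc k ⌉

  module Width = Widths W R υ (suc k) 0<block

  w M : ℕ
  w = proj₁ Width.memory
  M = (suc p ℕ.+ u) ℕ.+ p ℕ.+ q ℕ.+ w ℕ.+ suc k

  M-≥ : 2 ℕ.* n ℕ.+ 1 ℕ.+ suc k ℕ.≤ M ℕ.+ q
  M-≥ = memory-≥ p u q w (suc k) n
    (⌈log₂⌉-factors-≥ block (suc k) (subst (2 ℕ.^ n ℕ.≤_) (sym block*k≡W) 2^n≤W))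

  M-≤ : M ℕ.≤ 2 ℕ.* n ℕ.+ 7 ℕ.+ u ℕ.+ k
  M-≤ = memory-≤ p u q w k n
    (⌈log₂⌉-factors-≤ {n} block (suc k) {{ℕ.>-nonZero 0<block}} (subst (ℕ._< 2 ℕ.^ suc n) (sym block*k≡W) W<2^1+n))
    (proj₁ (proj₂ Width.memory))

  u-bound : 2 ℕ.^ u ℕ.< 8 ℕ.* suc k ℕ.* suc n
  u-bound = subst (2 ℕ.^ u ℕ.<_) (regroup k n) (fractional-width υ (s≤s z≤n)
    (subst (2^ (υ ℤ.- 1ℤ) ℚ.<_)
      (trans (cong (ℚ._* ℕ→ℚ (suc n)) (sym (ℕ→ℚ-* 4 (suc k)))) (sym (ℕ→ℚ-* (4 ℕ.* suc k) (suc n))))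
      (2^υ-bound real 0<ε {W} {υ} υ-ceil {suc n} {ℕ→ℚ (suc k)} {2^ (ℤ.- υ)}
        (ℕₚ.≤-trans (ℕₚ.m^n>0 2 n) 2^n≤W) (ℕₚ.<⇒≤ W<2^1+n) (0<2^ (ℤ.- υ)) (proj₂ k-ceil))))
    where
    regroup : ∀ k n → 2 ℕ.* (4 ℕ.* suc k ℕ.* suc n) ≡ 8 ℕ.* suc k ℕ.* suc n
    regroup = ℕ-solver.solve-∀

  -- With 1 + J = 4 (1 + N), the approximation of 1 / (2ε) by the number of blocks
  -- is allowed a relative error of 1 / (1 + J).
  J : ℕ
  J = 3 ℕ.+ 4 ℕ.* N

  J<n : suc J ℕ.< n
  J<n = ℕₚ.≤-trans (ℕₚ.≤-trans (ℕₚ.m≤m+n (suc (suc J)) _) (ℕₚ.≤-reflexive (slack N))) n≥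
    where
    slack : ∀ N → (5 ℕ.+ 4 ℕ.* N) ℕ.+ (29 ℕ.+ 36 ℕ.* N ℕ.+ 8 ℕ.* N ℕ.* N) ≡
      20 ℕ.* suc N ℕ.+ 2 ℕ.+ 2 ℕ.* (2 ℕ.* suc N ℕ.* suc (2 ℕ.* suc N))
    slack = ℕ-solver.solve-∀

  2ℚ : ℚ
  2ℚ = ℕ→ℚ 2

  -- Rational bounds on the target: 2 (n + 1) + (k + 1) from above, and
  -- 2n + k (1 - 1 / (1 + J)) from below.

  L-target : ∀ {c} → L target c → c ℚ.≤ ℕ→ℚ (2 ℕ.* n ℕ.+ 2 ℕ.+ suc k)
  L-target (c₁ , c₂ , Lc₁ , Lc₂ , refl) with L-2* {log (fromℕ W)} Lc₁
  ... | c , Lc , c₁<2c = begin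
    c₁ ℚ.+ c₂                                ≤⟨ ℚₚ.+-mono-≤ {c₁} {2ℚ ℚ.* ℕ→ℚ (suc n)} c₁≤
                                                (L-⁻¹-≤ {fromℕ 2 *ʳ ε} {2^ (ℤ.- υ)} {ℕ→ℚ (suc k)} (0<2^ (ℤ.- υ)) (proj₂ k-ceil) Lc₂) ⟩
    2ℚ ℚ.* ℕ→ℚ (suc n) ℚ.+ ℕ→ℚ (suc k)       ≡⟨ cong (ℚ._+ ℕ→ℚ (suc k)) (ℕ→ℚ-* 2 (suc n)) ⟨
    ℕ→ℚ (2 ℕ.* suc n) ℚ.+ ℕ→ℚ (suc k)        ≡⟨ ℕ→ℚ-+ (2 ℕ.* suc n) (suc k) ⟨
    ℕ→ℚ (2 ℕ.* suc n ℕ.+ suc k)              ≡⟨ cong ℕ→ℚ (regroup n k) ⟩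
    ℕ→ℚ (2 ℕ.* n ℕ.+ 2 ℕ.+ suc k)            ∎
    where
    open ℚₚ.≤-Reasoning
    c₁≤ : c₁ ℚ.≤ 2ℚ ℚ.* ℕ→ℚ (suc n)
    c₁≤ = ℚₚ.<⇒≤ (ℚₚ.<-trans c₁<2c (ℚₚ.*-monoʳ-<-pos 2ℚ (L-log-fromℕ {W} (suc n) {c} (ℕₚ.<⇒≤ W<2^1+n) Lc)))
    regroup : ∀ n k → 2 ℕ.* suc n ℕ.+ suc k ≡ 2 ℕ.* n ℕ.+ 2 ℕ.+ suc k
    regroup = ℕ-solver.solve-∀

  U-2log : ∀ {d} → U (fromℕ 2 *ʳ log (fromℕ W)) d → ℕ→ℚ (2 ℕ.* n) ℚ.≤ d
  U-2log Ud with U-2* {log (fromℕ W)} Ud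
  ... | d , Ud′ , 2d<  = ℚₚ.≤-trans (ℚₚ.≤-reflexive (ℕ→ℚ-* 2 n))
    (ℚₚ.<⇒≤ (ℚₚ.<-trans (ℚₚ.*-monoʳ-<-pos 2ℚ (U-log-fromℕ {W} n {d} 2^n≤W Ud′)) 2d<))

  U-target≥0 : ∀ {d} → U target d → 0ℚ ℚ.≤ d
  U-target≥0 (d₁ , d₂ , Ud₁ , Ud₂ , refl) =
    ℚₚ.+-mono-≤ {0ℚ} {d₁} {0ℚ} (ℚₚ.≤-trans (0≤ℕ→ℚ (2 ℕ.* n)) (U-2log Ud₁)) (ℚₚ.<⇒≤ (U-⁻¹-pos {fromℕ 2 *ʳ ε} Ud₂))

  U-target : ∀ {d} → U target d → ℕ→ℚ (8 ℕ.* suc N ℕ.* n ℕ.+ k ℕ.* J) ℚ.≤ d ℚ.* ℕ→ℚ (suc J)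
  U-target (d₁ , d₂ , Ud₁ , Ud₂ , refl) = begin
    ℕ→ℚ (8 ℕ.* suc N ℕ.* n ℕ.+ k ℕ.* J)                  ≡⟨ cong ℕ→ℚ (regroup N n k) ⟩
    ℕ→ℚ (2 ℕ.* n ℕ.* suc J ℕ.+ k ℕ.* J)                  ≡⟨ ℕ→ℚ-+ (2 ℕ.* n ℕ.* suc J) (k ℕ.* J) ⟩
    ℕ→ℚ (2 ℕ.* n ℕ.* suc J) ℚ.+ ℕ→ℚ (k ℕ.* J)            ≡⟨ cong₂ ℚ._+_ (ℕ→ℚ-* (2 ℕ.* n) (suc J)) (ℕ→ℚ-* k J) ⟩
    ℕ→ℚ (2 ℕ.* n) ℚ.* S ℚ.+ ℕ→ℚ k ℚ.* ℕ→ℚ J              ≤⟨ ℚₚ.+-mono-≤ {ℕ→ℚ (2 ℕ.* n) ℚ.* S} {d₁ ℚ.* S}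
                                                            (ℚₚ.*-monoʳ-≤-nonNeg S {{ℚ.nonNegative (0≤ℕ→ℚ (suc J))}} (U-2log Ud₁))
                                                            (U-⁻¹-≥ real 0<ε {J} {k} {2^ (ℤ.- υ)} {d₂} small (proj₁ k-ceil) Ud₂) ⟩
    d₁ ℚ.* S ℚ.+ d₂ ℚ.* S                                ≡⟨ ℚₚ.*-distribʳ-+ S d₁ d₂ ⟨
    (d₁ ℚ.+ d₂) ℚ.* S                                    ∎
    where
    open ℚₚ.≤-Reasoning
    S : ℚ
    S = ℕ→ℚ (suc J)
    small : ∀ {e} → U ε e → S ℚ.* 2^ (ℤ.- υ) ℚ.≤ 2ℚ ℚ.* e
    small {e} Ue = 2^-υ-small real 0<ε {W} {υ} υ-ceil {suc J} {suc n} {e}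
      (ℕₚ.<-≤-trans (ℕₚ.^-monoʳ-< 2 (s≤s (s≤s z≤n)) J<n) 2^n≤W) W<2^1+n Ue
    regroup : ∀ N n k → 8 ℕ.* suc N ℕ.* n ℕ.+ k ℕ.* (3 ℕ.+ 4 ℕ.* N) ≡ 2 ℕ.* n ℕ.* (4 ℕ.+ 4 ℕ.* N) ℕ.+ k ℕ.* (3 ℕ.+ 4 ℕ.* N)
    regroup = ℕ-solver.solve-∀

  lower : fromℚ (1ℚ ℚ.- δ) *ʳ target ≤ʳ fromℕ M
  lower = scale-≤ʳ {1ℚ ℚ.- δ} {target} {X} {ℕ→ℚ M} (0≤ℕ→ℚ M) U-target≥0 L-target
    (lower-scaled {δ} {ℕ→ℚ N} {X} {ℕ→ℚ M} (0≤ℕ→ℚ N) 1≤δN (0≤ℕ→ℚ (2 ℕ.* n ℕ.+ 2 ℕ.+ suc k))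
      (subst₂ ℚ._≤_ (ℕ→ℚ-* N (2 ℕ.* n ℕ.+ 2 ℕ.+ suc k)) (ℕ→ℚ-suc-* N M)
        (ℕ→ℚ-mono-≤ {N ℕ.* (2 ℕ.* n ℕ.+ 2 ℕ.+ suc k)} {suc N ℕ.* M} (lower-arith {N} {n} {suc k} {M} n≥ M-≥))))
    where
    X : ℚ
    X = ℕ→ℚ (2 ℕ.* n ℕ.+ 2 ℕ.+ suc k)

  upper : fromℕ M ≤ʳ fromℚ (1ℚ ℚ.+ δ) *ʳ target
  upper = ≤ʳ-scale {1ℚ ℚ.+ δ} {target} {ℕ→ℚ M} λ {d} Ud →
    upper-scaled {δ} {ℕ→ℚ N} {ℕ→ℚ (suc J)} {ℕ→ℚ Y} {d} {ℕ→ℚ M} (0≤ℕ→ℚ N) (ℕ→ℚ-mono-< {0} {suc J} (s≤s z≤n))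
      (U-target≥0 Ud) 1≤δN (U-target Ud)
      (subst₂ ℚ._≤_
        (trans (ℕ→ℚ-* (suc J) (suc N ℕ.* M)) (cong (ℕ→ℚ (suc J) ℚ.*_) (ℕ→ℚ-suc-* N M)))
        (trans (ℕ→ℚ-suc-* (suc N) Y) (cong (λ a → (1ℚ ℚ.+ a) ℚ.* ℕ→ℚ Y) (ℕ→ℚ-+ 1 N)))
        (ℕ→ℚ-mono-≤ {suc J ℕ.* (suc N ℕ.* M)} {suc (suc N) ℕ.* Y}
          (subst (λ a → a ℕ.* (suc N ℕ.* M) ℕ.≤ suc (suc N) ℕ.* Y) (ℕₚ.*-suc 4 N)
            (upper-arith {N} {n} {k} {u} {M} (fractional-arith {suc N} {n} {k} {u} n≥ u-bound) M-≤))))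
    where
    Y : ℕ
    Y = 8 ℕ.* suc N ℕ.* n ℕ.+ k ℕ.* J

  bounds : ∃[ M ] RequiresBits M × fromℚ (1ℚ ℚ.- δ) *ʳ target ≤ʳ fromℕ M × fromℕ M ≤ʳ fromℚ (1ℚ ℚ.+ δ) *ʳ target
  bounds = M , proj₂ (proj₂ Width.memory) , lower , upper

theorem16 : ∀ (δ : ℚ) → 0ℚ ℚ.< δ →
    ∃[ W₀ ]
    (∀ (W R : ℕ) .{{_ : NonZero W}} .{{_ : NonZero R}} → W₀ ℕ.≤ W →
    ∀ (ε : Cut) → IsReal ε → fromℕ 0 <ʳ ε →
    ε ⁻¹ ≤ʳ fromℕ 2 *ʳ fromℕ W *ʳ (fromℕ 1 -ʳ log (fromℕ W) ⁻¹) →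
    ∀ (υ : ℤ) → IsCeiling υ (log (ε ⁻¹ *ʳ log (fromℕ W))) →
    ∀ (k : ℕ) .{{_ : NonZero k}} →
    IsCeiling (+ k) ((fromℕ 2 *ʳ ε -ʳ fromℚ (2^ (ℤ.- υ))) ⁻¹) →
    k ∣ W →
    let target = fromℕ 2 *ʳ log (fromℕ W) +ʳ (fromℕ 2 *ʳ ε) ⁻¹
    in ∃[ M ] Algorithm.RequiresBits W R υ k M
    × fromℚ (1ℚ ℚ.- δ) *ʳ target ≤ʳ fromℕ M
    × fromℕ M ≤ʳ fromℚ (1ℚ ℚ.+ δ) *ʳ target)
theorem16 δ 0<δ = let N , 1≤δN = archimedean 0<δ in
  2 ℕ.^ threshold (suc N) , λ where
    W R W₀≤W ε real 0<ε _ υ υ-ceil (suc k) k-ceil k∣W →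
      let n , 2^n≤W , W<2^1+n = ⌊log₂⌋-exists W
          n≥ = ℕ.s≤s⁻¹ (2^-cancel-< (ℕₚ.≤-<-trans W₀≤W W<2^1+n))
      in Asymptotics.bounds {δ} N 1≤δN {W} {R} {n} n≥ 2^n≤W W<2^1+n real 0<ε υ-ceil k-ceil k∣W
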